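{- Let $G=K_s^t$ with $2\leq t\leq s$, $s+t=n$, and let $\tilde G=K_n^{n_1,\ldots,n_k}$ with $k\geq 2$, $n_i\geq1$, $\sum_{i=1}^k n_i+1=n$. Then $G$ and $\tilde G$ are not $D$-cospectral.
   Context: All graphs are simple, undirected and connected. $D(G)$ is the distance matrix of $G$ (entries are shortest-path distances); two graphs are $D$-cospectral if their distance matrices have the same spectrum. For $2\leq t\leq s$, $K_s^t$ is the graph on $n=s+t$ vertices obtained from the complete graph $K_s$ by attaching a pendant edge (to a new vertex) at each of $t$ distinct vertices of $K_s$. For $k\geq 2$ and positive integers $n_1,\dots,n_k$ with $n=\sum n_i+1$, $K_n^{n_1,\ldots,n_k}$ is the graph with a vertex $v$ of degree $n-1$ such that $G-v$ is the disjoint union of complete graphs $K_{n_1},\dots,K_{n_k}$. -}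

module Defs where

open import Data.Bool using (Bool; true; false; _∧_; _∨_; not; if_then_else_)
open import Data.Nat as ℕ using (ℕ; zero; suc; _<ᵇ_; _∸_)
open import Data.Fin as Fin using (Fin; zero; suc; toℕ; splitAt; punchIn)
open import Data.Sum using (_⊎_; inj₁; inj₂)
open import Data.List using (List; []; _∷_)
open import Data.Integer as ℤ using (ℤ; +_)
open import Relation.Nullary.Decidable using (⌊_⌋)

-- Simple graphs on the vertex set Fin n, given by a Boolean adjacency
-- function (symmetric and irreflexive for the graphs used below).

record Graph : Set where
  field
    order : ℕ
    adj   : Fin order → Fin order → Bool
open Graph public

anyFin : ∀ n → (Fin n → Bool) → Bool
anyFin zero    f = false
anyFin (suc n) f = f zero ∨ anyFin n (λ i → f (suc i))

_==ᶠ_ : ∀ {n} → Fin n → Fin n → Bool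
u ==ᶠ v = ⌊ u Fin.≟ v ⌋

reach : (G : Graph) → ℕ → Fin (order G) → Fin (order G) → Bool
reach G zero    u v = u ==ᶠ v
reach G (suc k) u v =
  reach G k u v ∨ anyFin (order G) (λ w → adj G u w ∧ reach G k w v)

-- shortest-path distance: least k with a walk of length ≤ k from u to v
-- (searched among 0 … order G; exact for connected graphs).
distSearch : (G : Graph) → Fin (order G) → Fin (order G) → ℕ → ℕ → ℕ
distSearch G u v k zero       = k
distSearch G u v k (suc fuel) =
  if reach G k u v then k else distSearch G u v (suc k) fuel

dist : (G : Graph) → Fin (order G) → Fin (order G) → ℕ
dist G u v = distSearch G u v 0 (order G)

Connected : Graph → Set
Connected G = ∀ u v → reach G (order G) u v ≡ true
  where open import Relation.Binary.PropositionalEquality using (_≡_)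

-- Polynomials over ℤ as coefficient lists (lowest degree first).

Poly : Set
Poly = List ℤ

infixl 6 _⊕_
infixl 7 _⊗_

_⊕_ : Poly → Poly → Poly
[]       ⊕ q        = q
(a ∷ p)  ⊕ []       = a ∷ p
(a ∷ p)  ⊕ (b ∷ q)  = (a ℤ.+ b) ∷ (p ⊕ q)

scale : ℤ → Poly → Poly
scale c []      = []
scale c (a ∷ p) = (c ℤ.* a) ∷ scale c p

_⊗_ : Poly → Poly → Poly
[]      ⊗ q = []
(a ∷ p) ⊗ q = scale a q ⊕ (ℤ.0ℤ ∷ (p ⊗ q))

negP : Poly → Poly
negP = scale (ℤ.- ℤ.1ℤ)

constP : ℤ → Poly
constP c = c ∷ []

X : Poly
X = ℤ.0ℤ ∷ ℤ.1ℤ ∷ []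

coeff : Poly → ℕ → ℤ
coeff []      _       = ℤ.0ℤ
coeff (a ∷ p) zero    = a
coeff (a ∷ p) (suc i) = coeff p i

sumFin : ∀ n → (Fin n → Poly) → Poly
sumFin zero    f = []
sumFin (suc n) f = f zero ⊕ sumFin n (λ i → f (suc i))

signP : ℕ → Poly → Poly
signP zero          p = p
signP (suc zero)    p = negP p
signP (suc (suc j)) p = signP j p

det : ∀ n → (Fin n → Fin n → Poly) → Poly
det zero    M = constP ℤ.1ℤ
det (suc n) M =
  sumFin (suc n) (λ j →
    signP (toℕ j) (M zero j ⊗ det n (λ r c → M (suc r) (punchIn j c))))

distMatrix : (G : Graph) → Fin (order G) → Fin (order G) → ℤ
distMatrix G u v = + dist G u v

charPolyD : Graph → Poly
charPolyD G = det (order G) (λ u v →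
  (if u ==ᶠ v then X else []) ⊕ negP (constP (distMatrix G u v)))

DCospectral : Graph → Graph → Set
DCospectral G H = order G ≡ order H × (∀ i → coeff (charPolyD G) i ≡ coeff (charPolyD H) i)
  where open import Relation.Binary.PropositionalEquality using (_≡_)
        open import Data.Product using (_×_)

-- K_s^t : K_s on Fin s, plus t pendant vertices (Fin t); pendant j is
-- attached to clique vertex j (requires t ≤ s). Vertex set Fin (s + t).

adjKst : ∀ s t → Fin s ⊎ Fin t → Fin s ⊎ Fin t → Bool
adjKst s t (inj₁ a) (inj₁ b) = not (a ==ᶠ b)
adjKst s t (inj₁ a) (inj₂ j) = ⌊ toℕ a ℕ.≟ toℕ j ⌋
adjKst s t (inj₂ j) (inj₁ a) = ⌊ toℕ a ℕ.≟ toℕ j ⌋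
adjKst s t (inj₂ i) (inj₂ j) = false

Kst : ℕ → ℕ → Graph
Kst s t = record { order = s ℕ.+ t ; adj = λ u v → adjKst s t (splitAt s u) (splitAt s v) }

-- K_n^{n_1,…,n_k}: vertex zero is the centre v; the remaining
-- n_1 + … + n_k vertices are split consecutively into blocks of sizes
-- n_1, …, n_k, each block forming a clique.
blockOf : List ℕ → ℕ → ℕ
blockOf []       j = 0
blockOf (a ∷ as) j = if j <ᵇ a then 0 else suc (blockOf as (j ∸ a))

sumL : List ℕ → ℕ
sumL []       = 0
sumL (a ∷ as) = a ℕ.+ sumL as

adjKn : (ns : List ℕ) → Fin (suc (sumL ns)) → Fin (suc (sumL ns)) → Bool
adjKn ns zero    zero    = false
adjKn ns zero    (suc j) = true
adjKn ns (suc i) zero    = true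
adjKn ns (suc i) (suc j) =
  not (i ==ᶠ j) ∧ ⌊ blockOf ns (toℕ i) ℕ.≟ blockOf ns (toℕ j) ⌋

Kn : List ℕ → Graph
Kn ns = record { order = suc (sumL ns) ; adj = adjKn ns }

{-# OPTIONS --safe #-}
module Submission where

-- Write φ for the D-characteristic polynomial, N = n_1 + … + n_k and r = s - t.
-- At x = -1/2 both polynomials factor: 2^n φ(-1/2) is -(2t + 1)(2s - 1) for
-- K_s^t and -∏(2n_i + 1) for K_n^{n_1,…,n_k}. At x = -1 the latter vanishes to
-- order at least N - k, the former to order at most r, so N - k ≤ r, that is
-- k ≥ 2t - 1. But ∏(2n_i + 1) ≥ 3^(k-1) (2(N - k) + 3), and since N = 2t + r - 1
-- this exceeds (2t + 1)(2s - 1) as soon as t ≥ 2.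

-- Determinants are evaluated at integers only. The value at -1/2 is pinned down by congruences
-- modulo all odd numbers, and a zero of order m at -1 shows as divisibility of the value at y - 1
-- by y^m. Write I for an identity and J for an all-ones matrix. The point -1 counts twins: if two
-- adjacent vertices have the same other neighbours, their rows in (y - 1)I - D differ by y(e_i -
-- e_j), so a clique of m twins contributes y^(m-1). The blocks of K_n^{n_1,...,n_k} are such
-- cliques, and so are the r clique vertices of K_s^t without a pendant. Such a count is only a
-- lower bound, while K_s^t needs an upper one: for r ≥ 1, once y^(r-1) is taken out, the cofactor
-- is ±r modulo y, hence not divisible by y = r + 1; for r = 0 the value at -1 itself is ±(t-1)^2.
-- The point -1/2 is where both graphs decouple: in -I - 2D, subtracting twice the centre's row from
-- all block rows, or twice its neighbour's row from each pendant row, makes the matrix block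
-- triangular. Apart from the entry of the centre, the diagonal blocks are built from I + 2J and I -
-- 2J.

open import Defs
open import Data.Nat as ℕ using (ℕ; zero; suc; _≤_; z≤n; s≤s)
import Data.Nat.Properties as ℕ
import Data.Nat.Divisibility as ℕ
import Data.Nat.Tactic.RingSolver as ℕ
open import Data.Nat.ListAction using (product)
open import Data.Bool using (Bool; if_then_else_; true; false; _∧_; _∨_; not)
open import Data.Bool.Properties using (∨-zeroʳ)
open import Data.Fin as Fin using (Fin; zero; suc; toℕ; punchIn; _↑ˡ_; _↑ʳ_; splitAt; fromℕ<)
open import Data.Fin.Properties using (suc-injective; toℕ-injective; toℕ-fromℕ<; toℕ<n; toℕ-↑ˡ; toℕ-↑ʳ; splitAt-↑ˡ; splitAt-↑ʳ; splitAt⁻¹-↑ˡ; splitAt⁻¹-↑ʳ; +↔⊎)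
open import Data.Integer as ℤ using (ℤ; +_; 0ℤ; 1ℤ; -1ℤ; _+_; _*_; -_; _-_; _^_; ∣_∣)
open import Data.Integer.Properties
open import Data.Integer.Divisibility.Signed using (_∣_; divides; ∣-refl; ∣-trans; ∣m∣n⇒∣m+n; ∣m∣n⇒∣m-n; ∣n⇒∣m*n; ∣m⇒∣m*n; *-cancelˡ-∣; ∣⇒∣ᵤ; 0∣⇒≡0)
open import Data.Integer.Tactic.RingSolver using (solve-∀)
open import Data.List using (List; []; _∷_; map; length)
open import Data.List.Relation.Unary.All using (All; []; _∷_)
open import Data.Product using (_×_; _,_; ∃; ∃₂)
open import Data.Sum as Sum using (_⊎_; inj₁; inj₂)
open import Data.Sum.Properties using (≡-dec; inj₁-injective; inj₂-injective)
open import Data.Sum.Function.Propositional using (_⊎-↔_)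
open import Data.Vec.Functional using (updateAt)
open import Data.Vec.Functional.Properties using (updateAt-updates; updateAt-minimal)
open import Algebra.Properties.Semiring.Sum +-*-semiring using (sum; sum-cong-≗; ∑-comm; *-distribˡ-sum; *-distribʳ-sum)
open import Algebra.Properties.Semiring.Sum ℕ.+-*-semiring using () renaming (sum to sumℕ; sum-cong-≗ to sumℕ-cong)
open import Function using (_∘_; const; flip; _↔_; Inverse; mk⇔)
open import Function.Construct.Composition using (_↔-∘_)
open import Function.Construct.Identity using (↔-id)
open import Relation.Binary using (DecidableEquality; tri<; tri≈; tri>)
open import Relation.Binary.PropositionalEquality
open import Relation.Nullary using (¬_; Dec; does; yes; no; contradiction)
open import Relation.Nullary.Decidable using (does-⇔; dec-true; dec-false; isYes≗does; ⌊_⌋)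

open Inverse using (to; from; strictlyInverseˡ; strictlyInverseʳ)

-- Determinants over ℤ

Matrix : ℕ → Set
Matrix n = Fin n → Fin n → ℤ

sign : ℕ → ℤ
sign zero    = 1ℤ
sign (suc k) = - sign k

minor : ∀ {n} → Matrix (suc n) → Fin (suc n) → Matrix n
minor M j r c = M (suc r) (punchIn j c)

detℤ : ∀ {n} → Matrix n → ℤ
detℤ {zero}  M = 1ℤ
detℤ {suc n} M = sum λ j → sign (toℕ j) * (M zero j * detℤ (minor M j))

detℤ-cong : ∀ {n} {A B : Matrix n} → (∀ r c → A r c ≡ B r c) → detℤ A ≡ detℤ B
detℤ-cong {zero}  A≡B = refl
detℤ-cong {suc n} A≡B = sum-cong-≗ λ j →
  cong (sign (toℕ j) *_) (cong₂ _*_ (A≡B zero j) (detℤ-cong λ r c → A≡B (suc r) (punchIn j c)))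

sum-zero : ∀ {n} (f : Fin n → ℤ) → (∀ i → f i ≡ 0ℤ) → sum f ≡ 0ℤ
sum-zero {zero}  f f≡0 = refl
sum-zero {suc n} f f≡0 = cong₂ _+_ (f≡0 zero) (sum-zero (f ∘ suc) (f≡0 ∘ suc))

sum-linear : ∀ {n} (f g h : Fin n → ℤ) β γ → (∀ i → f i ≡ β * g i + γ * h i) →
             sum f ≡ β * sum g + γ * sum h
sum-linear {zero}  f g h β γ eq = lemma β γ
  where
  lemma : ∀ β γ → 0ℤ ≡ β * 0ℤ + γ * 0ℤ
  lemma = solve-∀
sum-linear {suc n} f g h β γ eq =
  trans (cong₂ _+_ (eq zero) (sum-linear (f ∘ suc) (g ∘ suc) (h ∘ suc) β γ (eq ∘ suc)))
        (lemma β γ (g zero) (h zero) (sum (g ∘ suc)) (sum (h ∘ suc)))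
  where
  lemma : ∀ β γ a b c d → (β * a + γ * b) + (β * c + γ * d) ≡ β * (a + c) + γ * (b + d)
  lemma = solve-∀

detℤ-linear : ∀ {n} (i : Fin n) (A B C : Matrix n) (β γ : ℤ) →
              (∀ r → r ≢ i → ∀ c → B r c ≡ A r c) →
              (∀ r → r ≢ i → ∀ c → C r c ≡ A r c) →
              (∀ c → A i c ≡ β * B i c + γ * C i c) →
              detℤ A ≡ β * detℤ B + γ * detℤ C
detℤ-linear {suc n} zero A B C β γ B≡A C≡A eq = sum-linear _ _ _ β γ λ j → begin
  sign (toℕ j) * (A zero j * detℤ (minor A j))
    ≡⟨ cong (λ a → sign (toℕ j) * (a * detℤ (minor A j))) (eq j) ⟩
  sign (toℕ j) * ((β * B zero j + γ * C zero j) * detℤ (minor A j))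
    ≡⟨ lemma (sign (toℕ j)) β γ (B zero j) (C zero j) (detℤ (minor A j)) ⟩
  β * (sign (toℕ j) * (B zero j * detℤ (minor A j))) + γ * (sign (toℕ j) * (C zero j * detℤ (minor A j)))
    ≡⟨ cong₂ (λ b c → β * (sign (toℕ j) * (B zero j * b)) + γ * (sign (toℕ j) * (C zero j * c)))
         (detℤ-cong λ r c → B≡A (suc r) (λ ()) (punchIn j c))
         (detℤ-cong λ r c → C≡A (suc r) (λ ()) (punchIn j c)) ⟨
  β * (sign (toℕ j) * (B zero j * detℤ (minor B j))) + γ * (sign (toℕ j) * (C zero j * detℤ (minor C j))) ∎
  where
  open ≡-Reasoning
  lemma : ∀ s β γ b c m → s * ((β * b + γ * c) * m) ≡ β * (s * (b * m)) + γ * (s * (c * m))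
  lemma = solve-∀
detℤ-linear {suc n} (suc i) A B C β γ B≡A C≡A eq = sum-linear _ _ _ β γ λ j → begin
  sign (toℕ j) * (A zero j * detℤ (minor A j))
    ≡⟨ cong (λ m → sign (toℕ j) * (A zero j * m))
         (detℤ-linear i (minor A j) (minor B j) (minor C j) β γ
           (λ r r≢i c → B≡A (suc r) (r≢i ∘ suc-injective) (punchIn j c))
           (λ r r≢i c → C≡A (suc r) (r≢i ∘ suc-injective) (punchIn j c))
           (λ c → eq (punchIn j c))) ⟩
  sign (toℕ j) * (A zero j * (β * detℤ (minor B j) + γ * detℤ (minor C j)))
    ≡⟨ lemma (sign (toℕ j)) β γ (A zero j) (detℤ (minor B j)) (detℤ (minor C j)) ⟩
  β * (sign (toℕ j) * (A zero j * detℤ (minor B j))) + γ * (sign (toℕ j) * (A zero j * detℤ (minor C j)))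
    ≡⟨ cong₂ (λ b c → β * (sign (toℕ j) * (b * detℤ (minor B j))) + γ * (sign (toℕ j) * (c * detℤ (minor C j))))
         (B≡A zero (λ ()) j) (C≡A zero (λ ()) j) ⟨
  β * (sign (toℕ j) * (B zero j * detℤ (minor B j))) + γ * (sign (toℕ j) * (C zero j * detℤ (minor C j))) ∎
  where
  open ≡-Reasoning
  lemma : ∀ s β γ a m k → s * (a * (β * m + γ * k)) ≡ β * (s * (a * m)) + γ * (s * (a * k))
  lemma = solve-∀

minorᶜ : ∀ {n} → Matrix (suc n) → Fin (suc n) → Matrix n
minorᶜ M i r c = M (punchIn i r) (suc c)

-- Expand each minor of a later column along its own first column and exchange the two sums.
-- Deleting rows 0, i + 1 and columns 0, j + 1 leaves the same matrix `both i j` in either order,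
-- and the two signs agree.
detℤ-column-expansion : ∀ {n} (M : Matrix (suc n)) →
  detℤ M ≡ sum λ i → sign (toℕ i) * (M i zero * detℤ (minorᶜ M i))
detℤ-column-expansion {zero}  M = refl
detℤ-column-expansion {suc n} M = cong (λ z → 1ℤ * (M zero zero * detℤ (minor M zero)) + z) (begin
  sum (λ j → sign (suc (toℕ j)) * (M zero (suc j) * detℤ (minor M (suc j))))
    ≡⟨ sum-cong-≗ (λ j → trans
         (cong (λ m → sign (suc (toℕ j)) * (M zero (suc j) * m)) (detℤ-column-expansion (minor M (suc j))))
         (push (sign (suc (toℕ j))) (M zero (suc j)) λ i →
           sign (toℕ i) * (M (suc i) zero * detℤ (both i j)))) ⟩
  sum (λ j → sum λ i → sign (suc (toℕ j)) * (M zero (suc j) * (sign (toℕ i) * (M (suc i) zero * detℤ (both i j)))))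
    ≡⟨ ∑-comm (λ j i → sign (suc (toℕ j)) * (M zero (suc j) * (sign (toℕ i) * (M (suc i) zero * detℤ (both i j))))) ⟩
  sum (λ i → sum λ j → sign (suc (toℕ j)) * (M zero (suc j) * (sign (toℕ i) * (M (suc i) zero * detℤ (both i j)))))
    ≡⟨ sum-cong-≗ (λ i → sum-cong-≗ λ j →
         lemma (sign (toℕ j)) (M zero (suc j)) (sign (toℕ i)) (M (suc i) zero) (detℤ (both i j))) ⟩
  sum (λ i → sum λ j → sign (suc (toℕ i)) * (M (suc i) zero * (sign (toℕ j) * (M zero (suc j) * detℤ (both i j)))))
    ≡⟨ sum-cong-≗ (λ i → push (sign (suc (toℕ i))) (M (suc i) zero) λ j →
         sign (toℕ j) * (M zero (suc j) * detℤ (both i j))) ⟨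
  sum (λ i → sign (suc (toℕ i)) * (M (suc i) zero * detℤ (minorᶜ M (suc i)))) ∎)
  where
  open ≡-Reasoning
  both : Fin (suc n) → Fin (suc n) → Matrix n
  both i j r c = M (suc (punchIn i r)) (suc (punchIn j c))
  push : ∀ {m} a b (f : Fin m → ℤ) → a * (b * sum f) ≡ sum λ i → a * (b * f i)
  push a b f = trans (cong (a *_) (*-distribˡ-sum b f)) (*-distribˡ-sum a (λ i → b * f i))
  lemma : ∀ s a t b d → (- s) * (a * (t * (b * d))) ≡ (- t) * (b * (s * (a * d)))
  lemma = solve-∀

detℤ-transpose : ∀ {n} (M : Matrix n) → detℤ (flip M) ≡ detℤ M
detℤ-transpose {zero}  M = refl
detℤ-transpose {suc n} M = trans
  (sum-cong-≗ λ j → cong (λ m → sign (toℕ j) * (M j zero * m)) (detℤ-transpose (minorᶜ M j)))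
  (sym (detℤ-column-expansion M))

private
  -- Terms 0 and 1 of the expansion have equal entries, equal minors and opposite signs. Every later
  -- minor keeps both equal columns in front, so induction applies. Columns come before rows because
  -- the expansion runs along row 0.
  equal-columns₀₁ : ∀ {n} (M : Matrix (suc (suc n))) → (∀ r → M r zero ≡ M r (suc zero)) → detℤ M ≡ 0ℤ
  equal-columns₀₁ {n} M eq = begin
    1ℤ * (M zero zero * detℤ (minor M zero)) + ((- 1ℤ) * (M zero (suc zero) * detℤ (minor M (suc zero))) + rest)
      ≡⟨ cong₂ (λ a m → 1ℤ * (a * m) + ((- 1ℤ) * (M zero (suc zero) * detℤ (minor M (suc zero))) + rest))
           (eq zero) (detℤ-cong minors) ⟩
    1ℤ * (a * m) + ((- 1ℤ) * (a * m) + rest)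
      ≡⟨ cong (λ z → 1ℤ * (a * m) + ((- 1ℤ) * (a * m) + z)) (sum-zero _ (vanish M eq)) ⟩
    1ℤ * (a * m) + ((- 1ℤ) * (a * m) + 0ℤ)
      ≡⟨ lemma a m ⟩
    0ℤ ∎
    where
    open ≡-Reasoning
    a = M zero (suc zero)
    m = detℤ (minor M (suc zero))
    rest = sum λ (j : Fin n) → sign (suc (suc (toℕ j))) * (M zero (suc (suc j)) * detℤ (minor M (suc (suc j))))
    minors : ∀ r c → minor M zero r c ≡ minor M (suc zero) r c
    minors r zero    = sym (eq (suc r))
    minors r (suc c) = refl
    lemma : ∀ a m → 1ℤ * (a * m) + ((- 1ℤ) * (a * m) + 0ℤ) ≡ 0ℤ
    lemma = solve-∀
    vanish : ∀ {n} (M : Matrix (suc (suc n))) → (∀ r → M r zero ≡ M r (suc zero)) →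
             ∀ (j : Fin n) → sign (suc (suc (toℕ j))) * (M zero (suc (suc j)) * detℤ (minor M (suc (suc j)))) ≡ 0ℤ
    vanish {suc n} M eq j = trans
      (cong (λ z → sign (suc (suc (toℕ j))) * (M zero (suc (suc j)) * z))
            (equal-columns₀₁ (minor M (suc (suc j))) (eq ∘ suc)))
      (zeros (sign (suc (suc (toℕ j)))) (M zero (suc (suc j))))
      where
      zeros : ∀ s a → s * (a * 0ℤ) ≡ 0ℤ
      zeros = solve-∀

  equal-rows₀₁ : ∀ {n} (M : Matrix (suc (suc n))) → (∀ c → M zero c ≡ M (suc zero) c) → detℤ M ≡ 0ℤ
  equal-rows₀₁ M eq = trans (sym (detℤ-transpose M)) (equal-columns₀₁ (flip M) eq)

_[_]≔_ : ∀ {n} → Matrix n → Fin n → (Fin n → ℤ) → Matrix n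
M [ i ]≔ v = updateAt M i (const v)

[]≔-updates : ∀ {n} (M : Matrix n) i v c → (M [ i ]≔ v) i c ≡ v c
[]≔-updates M i v c = cong-app (updateAt-updates i M) c

[]≔-minimal : ∀ {n} (M : Matrix n) i v r → r ≢ i → ∀ c → (M [ i ]≔ v) r c ≡ M r c
[]≔-minimal M i v r r≢i c = cong-app (updateAt-minimal r i M r≢i) c

-- The case of rows 0 and j ≥ 2 reduces to rows 0, 1 and to rows 1, j by
-- expanding the determinant whose rows 1 and j both are M 1 + M j.
detℤ-alternating : ∀ {n} (M : Matrix n) i j → i ≢ j → (∀ c → M i c ≡ M j c) → detℤ M ≡ 0ℤ
detℤ-alternating {suc n} M i j i≢j eq = go i j i≢j eq
  where
  lower : ∀ (M : Matrix (suc n)) i j → i ≢ j → (∀ c → M (suc i) c ≡ M (suc j) c) → detℤ M ≡ 0ℤ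
  lower M i j i≢j eq = sum-zero _ λ k → trans
    (cong (λ z → sign (toℕ k) * (M zero k * z)) (detℤ-alternating (minor M k) i j i≢j (eq ∘ punchIn k)))
    (zeros (sign (toℕ k)) (M zero k))
    where
    zeros : ∀ s a → s * (a * 0ℤ) ≡ 0ℤ
    zeros = solve-∀
  -- `lower` is passed in because matching on `j` refines the dimension, which the enclosing scope
  -- keeps fixed.
  first : ∀ {n} → (∀ (M : Matrix (suc n)) i j → i ≢ j → (∀ c → M (suc i) c ≡ M (suc j) c) → detℤ M ≡ 0ℤ) →
          (M : Matrix (suc n)) → ∀ j → (∀ c → M zero c ≡ M (suc j) c) → detℤ M ≡ 0ℤ
  first {suc n} lower M zero    eq = equal-rows₀₁ M eq
  first {suc n} lower M (suc j) eq = begin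
    detℤ M                        ≡⟨ expand (detℤ M) (detℤ D) ⟩
    1ℤ * detℤ M + 1ℤ * detℤ D - detℤ D
      ≡⟨ cong₂ _-_ (sym C-expand) D≡0 ⟩
    detℤ C - 0ℤ                   ≡⟨ expand′ (detℤ B) (detℤ C) ⟩
    1ℤ * detℤ B + 1ℤ * detℤ C - detℤ B
      ≡⟨ cong₂ _-_ (sym A-expand) B≡0 ⟩
    detℤ A - 0ℤ                   ≡⟨ cong (_- 0ℤ) A≡0 ⟩
    0ℤ                            ∎
    where
    open ≡-Reasoning
    p = suc {n = suc n} zero
    q = suc (suc j)
    u = M q
    v = M p
    u+v = λ c → u c + v c
    C = M [ q ]≔ u+v
    D = M [ q ]≔ v
    A = C [ p ]≔ u+v
    B = C [ p ]≔ u
    q≢p : q ≢ p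
    q≢p ()
    p≢q : p ≢ q
    p≢q ()
    expand : ∀ a b → a ≡ 1ℤ * a + 1ℤ * b - b
    expand = solve-∀
    expand′ : ∀ a b → b - 0ℤ ≡ 1ℤ * a + 1ℤ * b - a
    expand′ = solve-∀
    ones : ∀ a b → a + b ≡ 1ℤ * a + 1ℤ * b
    ones = solve-∀
    A≡0 : detℤ A ≡ 0ℤ
    A≡0 = lower A zero (suc j) (λ ()) λ c → trans ([]≔-updates C p u+v c)
      (sym (trans ([]≔-minimal C p u+v q q≢p c) ([]≔-updates M q u+v c)))
    B≡0 : detℤ B ≡ 0ℤ
    B≡0 = equal-rows₀₁ B λ c → trans (trans ([]≔-minimal C p u zero (λ ()) c) ([]≔-minimal M q u+v zero (λ ()) c))
      (trans (eq c) (sym ([]≔-updates C p u c)))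
    D≡0 : detℤ D ≡ 0ℤ
    D≡0 = lower D zero (suc j) (λ ()) λ c → trans ([]≔-minimal M q v p p≢q c) (sym ([]≔-updates M q v c))
    A-expand : detℤ A ≡ 1ℤ * detℤ B + 1ℤ * detℤ C
    A-expand = detℤ-linear p A B C 1ℤ 1ℤ
      (λ r r≢p c → trans ([]≔-minimal C p u r r≢p c) (sym ([]≔-minimal C p u+v r r≢p c)))
      (λ r r≢p c → sym ([]≔-minimal C p u+v r r≢p c))
      (λ c → trans ([]≔-updates C p u+v c) (trans (ones (u c) (v c))
        (cong₂ (λ a b → 1ℤ * a + 1ℤ * b) (sym ([]≔-updates C p u c)) (sym ([]≔-minimal M q u+v p p≢q c)))))
    C-expand : detℤ C ≡ 1ℤ * detℤ M + 1ℤ * detℤ D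
    C-expand = detℤ-linear q C M D 1ℤ 1ℤ
      (λ r r≢q c → sym ([]≔-minimal M q u+v r r≢q c))
      (λ r r≢q c → trans ([]≔-minimal M q v r r≢q c) (sym ([]≔-minimal M q u+v r r≢q c)))
      (λ c → trans ([]≔-updates M q u+v c) (trans (ones (u c) (v c))
        (cong (λ b → 1ℤ * u c + 1ℤ * b) (sym ([]≔-updates M q v c)))))
  go : ∀ i j → i ≢ j → (∀ c → M i c ≡ M j c) → detℤ M ≡ 0ℤ
  go zero    zero    i≢j eq = contradiction refl i≢j
  go zero    (suc j) i≢j eq = first lower M j eq
  go (suc i) zero    i≢j eq = first lower M i (sym ∘ eq)
  go (suc i) (suc j) i≢j eq = lower M i j (i≢j ∘ cong suc) eq

detℤ-addRow : ∀ {n} (i j : Fin n) k (A B : Matrix n) → i ≢ j →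
              (∀ r → r ≢ i → ∀ c → A r c ≡ B r c) →
              (∀ c → A i c ≡ B i c + k * B j c) → detℤ A ≡ detℤ B
detℤ-addRow i j k A B i≢j A≡B eq = begin
  detℤ A                      ≡⟨ detℤ-linear i A B C 1ℤ k
                                   (λ r r≢i c → sym (A≡B r r≢i c))
                                   (λ r r≢i c → trans ([]≔-minimal B i (B j) r r≢i c) (sym (A≡B r r≢i c)))
                                   (λ c → trans (eq c) (cong₂ _+_ (sym (*-identityˡ (B i c)))
                                     (cong (k *_) (sym ([]≔-updates B i (B j) c))))) ⟩
  1ℤ * detℤ B + k * detℤ C    ≡⟨ cong (λ z → 1ℤ * detℤ B + k * z) (detℤ-alternating C i j i≢j λ c →
                                   trans ([]≔-updates B i (B j) c) (sym ([]≔-minimal B i (B j) j (i≢j ∘ sym) c))) ⟩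
  1ℤ * detℤ B + k * 0ℤ        ≡⟨ lemma (detℤ B) k ⟩
  detℤ B                      ∎
  where
  open ≡-Reasoning
  C = B [ i ]≔ B j
  lemma : ∀ b k → 1ℤ * b + k * 0ℤ ≡ b
  lemma = solve-∀

detℤ-addRows : ∀ {n m} (i : Fin n) (l : Fin m → Fin n) (k : Fin m → ℤ) (A B : Matrix n) →
               (∀ p → i ≢ l p) →
               (∀ r → r ≢ i → ∀ c → A r c ≡ B r c) →
               (∀ c → A i c ≡ B i c + sum λ p → k p * B (l p) c) → detℤ A ≡ detℤ B
detℤ-addRows {m = zero}  i l k A B i≢l A≡B eq = detℤ-cong λ r c → agree r c
  where
  agree : ∀ r c → A r c ≡ B r c
  agree r c with r Fin.≟ i
  ... | yes refl = trans (eq c) (+-identityʳ (B i c))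
  ... | no  r≢i  = A≡B r r≢i c
detℤ-addRows {m = suc m} i l k A B i≢l A≡B eq = trans
  (detℤ-addRows i (l ∘ suc) (k ∘ suc) A C (i≢l ∘ suc)
    (λ r r≢i c → trans (A≡B r r≢i c) (sym ([]≔-minimal B i v r r≢i c)))
    (λ c → trans (eq c) (trans (sym (+-assoc (B i c) _ _)) (cong₂ _+_
      (sym ([]≔-updates B i v c))
      (sum-cong-≗ λ p → cong (k (suc p) *_) (sym ([]≔-minimal B i v (l (suc p)) (i≢l (suc p) ∘ sym) c)))))))
  (detℤ-addRow i (l zero) (k zero) C B (i≢l zero)
    (λ r r≢i c → []≔-minimal B i v r r≢i c)
    (λ c → []≔-updates B i v c))
  where
  v = λ c → B i c + k zero * B (l zero) c
  C = B [ i ]≔ v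

-- Many row operations at once. The condition `k (l r) ≡ 0ℤ` says that pivot rows are themselves
-- unchanged, so the rows can be treated one at a time in any order; in `mix m` the first `m` rows
-- are done.
detℤ-eliminate : ∀ {n} (l : Fin n → Fin n) (k : Fin n → ℤ) (A B : Matrix n) →
                 (∀ r → k (l r) ≡ 0ℤ) →
                 (∀ r c → A r c ≡ B r c + k r * B (l r) c) → detℤ A ≡ detℤ B
detℤ-eliminate {n} l k A B kl≡0 eq =
  trans (detℤ-cong λ r c → sym (below n r (toℕ<n r) c)) (steps n ℕ.≤-refl)
  where
  open ≡-Reasoning
  mix : ℕ → Matrix n
  mix m r c = if does (toℕ r ℕ.<? m) then A r c else B r c
  below : ∀ m r → toℕ r ℕ.< m → ∀ c → mix m r c ≡ A r c
  below m r r<m c = cong (if_then A r c else B r c) (dec-true (toℕ r ℕ.<? m) r<m)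
  above : ∀ m r → m ℕ.≤ toℕ r → ∀ c → mix m r c ≡ B r c
  above m r m≤r c = cong (if_then A r c else B r c) (dec-false (toℕ r ℕ.<? m) (ℕ.≤⇒≯ m≤r))
  pivot : ∀ r c → k r ≡ 0ℤ → A r c ≡ B r c
  pivot r c kr≡0 = trans (eq r c) (trans (cong (λ z → B r c + z * B (l r) c) kr≡0) (+-identityʳ (B r c)))
  mix-pivot : ∀ m r c → k r ≡ 0ℤ → mix m r c ≡ B r c
  mix-pivot m r c kr≡0 with does (toℕ r ℕ.<? m)
  ... | true  = pivot r c kr≡0
  ... | false = refl
  steps : ∀ m → m ℕ.≤ n → detℤ (mix m) ≡ detℤ B
  steps zero    _   = refl
  steps (suc m) m<n = trans step (steps m (ℕ.<⇒≤ m<n))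
    where
    i = fromℕ< m<n
    i≡m : toℕ i ≡ m
    i≡m = toℕ-fromℕ< m<n
    others : ∀ r → r ≢ i → ∀ c → mix (suc m) r c ≡ mix m r c
    others r r≢i c with ℕ.<-cmp (toℕ r) m
    ... | tri< r<m _ _ = trans (below (suc m) r (ℕ.m<n⇒m<1+n r<m) c) (sym (below m r r<m c))
    ... | tri≈ _ r≡m _ = contradiction (toℕ-injective (trans r≡m (sym i≡m))) r≢i
    ... | tri> _ _ r>m = trans (above (suc m) r r>m c) (sym (above m r (ℕ.<⇒≤ r>m) c))
    step : detℤ (mix (suc m)) ≡ detℤ (mix m)
    step with i Fin.≟ l i
    ... | no  i≢li = detℤ-addRow i (l i) (k i) (mix (suc m)) (mix m) i≢li others λ c → begin
      mix (suc m) i c                    ≡⟨ below (suc m) i (ℕ.≤-reflexive (cong suc i≡m)) c ⟩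
      A i c                              ≡⟨ eq i c ⟩
      B i c + k i * B (l i) c            ≡⟨ cong₂ (λ x y → x + k i * y)
                                              (above m i (ℕ.≤-reflexive (sym i≡m)) c)
                                              (mix-pivot m (l i) c (kl≡0 i)) ⟨
      mix m i c + k i * mix m (l i) c    ∎
    -- A row that is its own pivot has coefficient 0 and does not change.
    ... | yes i≡li = detℤ-cong agree
      where
      ki≡0 = trans (cong k i≡li) (kl≡0 i)
      agree : ∀ r c → mix (suc m) r c ≡ mix m r c
      agree r c with r Fin.≟ i
      ... | yes refl = trans (mix-pivot (suc m) i c ki≡0) (sym (mix-pivot m i c ki≡0))
      ... | no  r≢i  = others r r≢i c

-- With `d` a 0/1 indicator, the exponent `sumℕ d` counts the rows from which a factor `y` is
-- extracted.
detℤ-scale : ∀ {n} (y : ℤ) (d : Fin n → ℕ) (A B : Matrix n) →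
             (∀ r c → A r c ≡ y ^ d r * B r c) → detℤ A ≡ y ^ sumℕ d * detℤ B
detℤ-scale {zero}  y d A B eq = refl
detℤ-scale {suc n} y d A B eq = begin
  detℤ A
    ≡⟨ sum-cong-≗ (λ j → trans
         (cong₂ (λ a m → sign (toℕ j) * (a * m)) (eq zero j)
           (detℤ-scale y (d ∘ suc) (minor A j) (minor B j) λ r c → eq (suc r) (punchIn j c)))
         (lemma (sign (toℕ j)) (y ^ d zero) (B zero j) (y ^ sumℕ (d ∘ suc)) (detℤ (minor B j)))) ⟩
  sum (λ j → y ^ d zero * y ^ sumℕ (d ∘ suc) * (sign (toℕ j) * (B zero j * detℤ (minor B j))))
    ≡⟨ *-distribˡ-sum (y ^ d zero * y ^ sumℕ (d ∘ suc)) (λ j → sign (toℕ j) * (B zero j * detℤ (minor B j))) ⟨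
  y ^ d zero * y ^ sumℕ (d ∘ suc) * detℤ B
    ≡⟨ cong (_* detℤ B) (^-distribˡ-+-* y (d zero) (sumℕ (d ∘ suc))) ⟨
  y ^ sumℕ d * detℤ B ∎
  where
  open ≡-Reasoning
  lemma : ∀ s p b q m → s * (p * b * (q * m)) ≡ p * q * (s * (b * m))
  lemma = solve-∀

sum-mod : ∀ {n} (m : ℤ) (f g : Fin n → ℤ) → (∀ i → m ∣ f i - g i) → m ∣ sum f - sum g
sum-mod {zero}  m f g m∣ = divides 0ℤ refl
sum-mod {suc n} m f g m∣ = subst (m ∣_) (lemma (f zero) (g zero) (sum (f ∘ suc)) (sum (g ∘ suc)))
  (∣m∣n⇒∣m+n (m∣ zero) (sum-mod m (f ∘ suc) (g ∘ suc) (m∣ ∘ suc)))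
  where
  lemma : ∀ a b c d → (a - b) + (c - d) ≡ (a + c) - (b + d)
  lemma = solve-∀

-- A determinant is an integer polynomial in the entries. This congruence replaces determinants over
-- a residue ring.
detℤ-mod : ∀ {n} (m : ℤ) (A B : Matrix n) → (∀ r c → m ∣ A r c - B r c) → m ∣ detℤ A - detℤ B
detℤ-mod {zero}  m A B m∣ = divides 0ℤ refl
detℤ-mod {suc n} m A B m∣ = sum-mod m (λ j → sign (toℕ j) * (A zero j * detℤ (minor A j))) (λ j → sign (toℕ j) * (B zero j * detℤ (minor B j))) λ j → subst (m ∣_)
  (lemma (sign (toℕ j)) (A zero j) (B zero j) (detℤ (minor A j)) (detℤ (minor B j)))
  (∣n⇒∣m*n (sign (toℕ j)) (∣m∣n⇒∣m+n
    (∣m⇒∣m*n (detℤ (minor A j)) (m∣ zero j))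
    (∣n⇒∣m*n (B zero j) (detℤ-mod m (minor A j) (minor B j) λ r c → m∣ (suc r) (punchIn j c)))))
  where
  lemma : ∀ s a b c d → s * ((a - b) * c + b * (c - d)) ≡ s * (a * c) - s * (b * d)
  lemma = solve-∀

detℤ-row₀ : ∀ {n} (M : Matrix (suc n)) → (∀ c → M zero (suc c) ≡ 0ℤ) →
            detℤ M ≡ M zero zero * detℤ (λ r c → M (suc r) (suc c))
detℤ-row₀ M eq = trans
  (cong (_+_ (1ℤ * (M zero zero * detℤ (minor M zero)))) (sum-zero _ λ j →
    trans (cong (λ z → sign (suc (toℕ j)) * (z * detℤ (minor M (suc j)))) (eq j)) (*-zeroʳ (sign (suc (toℕ j))))))
  (trans (+-identityʳ _) (*-identityˡ _))

-- Block triangular determinants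

sum-split : ∀ m {n} (f : Fin (m ℕ.+ n) → ℤ) → sum f ≡ sum (f ∘ (_↑ˡ n)) + sum (f ∘ (m ↑ʳ_))
sum-split zero    f = sym (+-identityˡ _)
sum-split (suc m) f = trans (cong (_+_ (f zero)) (sum-split m (f ∘ suc))) (sym (+-assoc (f zero) _ _))

punchIn-↑ˡ : ∀ {m} n (j : Fin (suc m)) c → punchIn (j ↑ˡ n) (c ↑ˡ n) ≡ punchIn j c ↑ˡ n
punchIn-↑ˡ n zero    c       = refl
punchIn-↑ˡ n (suc j) zero    = refl
punchIn-↑ˡ n (suc j) (suc c) = cong suc (punchIn-↑ˡ n j c)

punchIn-↑ʳ : ∀ m {n} (j : Fin (suc m)) (c : Fin n) → punchIn (j ↑ˡ n) (m ↑ʳ c) ≡ suc m ↑ʳ c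
punchIn-↑ʳ m       zero    c = refl
punchIn-↑ʳ (suc m) (suc j) c = cong suc (punchIn-↑ʳ m j c)

-- Induction on `m` along row 0: the right-hand columns contribute zeros, and every other minor is
-- block triangular with the same lower right block.
detℤ-block : ∀ m {n} (M : Matrix (m ℕ.+ n)) → (∀ i j → M (i ↑ˡ n) (m ↑ʳ j) ≡ 0ℤ) →
             detℤ M ≡ detℤ (λ i j → M (i ↑ˡ n) (j ↑ˡ n)) * detℤ (λ i j → M (m ↑ʳ i) (m ↑ʳ j))
detℤ-block zero        M eq = sym (*-identityˡ _)
detℤ-block (suc m) {n} M eq = begin
  detℤ M
    ≡⟨ sum-split (suc m) (λ j → sign (toℕ j) * (M zero j * detℤ (minor M j))) ⟩
  sum (λ j → sign (toℕ (j ↑ˡ n)) * (M zero (j ↑ˡ n) * detℤ (minor M (j ↑ˡ n)))) +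
  sum (λ j → sign (toℕ (suc m ↑ʳ j)) * (M zero (suc m ↑ʳ j) * detℤ (minor M (suc m ↑ʳ j))))
    ≡⟨ cong₂ _+_
         (sum-cong-≗ λ j → trans
           (cong₂ (λ k d → sign k * (M zero (j ↑ˡ n) * d)) (toℕ-↑ˡ j n) (minors j))
           (lemma (sign (toℕ j)) (M zero (j ↑ˡ n)) (detℤ (minor UL j)) (detℤ LR)))
         (sum-zero _ λ j → trans
           (cong (λ z → sign (toℕ (suc m ↑ʳ j)) * (z * detℤ (minor M (suc m ↑ʳ j)))) (eq zero j))
           (*-zeroʳ (sign (toℕ (suc m ↑ʳ j))))) ⟩
  sum (λ j → sign (toℕ j) * (UL zero j * detℤ (minor UL j)) * detℤ LR) + 0ℤ
    ≡⟨ +-identityʳ _ ⟩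
  sum (λ j → sign (toℕ j) * (UL zero j * detℤ (minor UL j)) * detℤ LR)
    ≡⟨ *-distribʳ-sum (detℤ LR) (λ j → sign (toℕ j) * (UL zero j * detℤ (minor UL j))) ⟨
  detℤ UL * detℤ LR ∎
  where
  open ≡-Reasoning
  UL : Matrix (suc m)
  UL i j = M (i ↑ˡ n) (j ↑ˡ n)
  LR : Matrix n
  LR i j = M (suc m ↑ʳ i) (suc m ↑ʳ j)
  minors : ∀ j → detℤ (minor M (j ↑ˡ n)) ≡ detℤ (minor UL j) * detℤ LR
  minors j = trans
    (detℤ-block m (minor M (j ↑ˡ n)) λ i c →
      trans (cong (M (suc (i ↑ˡ n))) (punchIn-↑ʳ m j c)) (eq (suc i) c))
    (cong₂ _*_
      (detℤ-cong λ r c → cong (M (suc (r ↑ˡ n))) (punchIn-↑ˡ n j c))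
      (detℤ-cong λ r c → cong (M (suc (m ↑ʳ r))) (punchIn-↑ʳ m j c)))
  lemma : ∀ s a d l → s * (a * (d * l)) ≡ s * (a * d) * l
  lemma = solve-∀

-- Kronecker deltas and the determinant of I + cJ

δ : ∀ {I : Set} → DecidableEquality I → I → I → ℤ
δ _≟_ i j = if does (i ≟ j) then 1ℤ else 0ℤ

δ-equal : ∀ {I : Set} (_≟_ : DecidableEquality I) {i j} → i ≡ j → δ _≟_ i j ≡ 1ℤ
δ-equal _≟_ {i} {j} i≡j = cong (if_then 1ℤ else 0ℤ) (dec-true (i ≟ j) i≡j)

δ-distinct : ∀ {I : Set} (_≟_ : DecidableEquality I) {i j} → i ≢ j → δ _≟_ i j ≡ 0ℤ
δ-distinct _≟_ {i} {j} i≢j = cong (if_then 1ℤ else 0ℤ) (dec-false (i ≟ j) i≢j)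

δᶠ : ∀ {n} → Fin n → Fin n → ℤ
δᶠ = δ Fin._≟_

detℤ-identity : ∀ n → detℤ (δᶠ {n}) ≡ 1ℤ
detℤ-identity zero    = refl
detℤ-identity (suc n) = trans (detℤ-row₀ (δᶠ {suc n}) (λ c → refl)) (trans (*-identityˡ (detℤ (δᶠ {n}))) (detℤ-identity n))

sum-δ : ∀ {n} (f : Fin n → ℤ) c → sum (λ k → f k * δᶠ k c) ≡ f c
sum-δ {suc n} f zero    = trans
  (cong₂ _+_ (*-identityʳ (f zero)) (sum-zero (λ k → f (suc k) * 0ℤ) λ k → *-zeroʳ (f (suc k)))) (+-identityʳ (f zero))
sum-δ {suc n} f (suc c) = trans (cong₂ _+_ (*-zeroʳ (f zero)) (sum-δ (f ∘ suc) c)) (+-identityˡ (f (suc c)))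

sum-const : ∀ n c → sum {n} (λ _ → c) ≡ + n * c
sum-const zero    c = refl
sum-const (suc n) c = trans (cong (_+_ c) (sum-const n c)) (sym (suc-* (+ n) c))

-- Below row 0 the rows are e_r - e_0. Subtracting `w r` times each of them from row 0 moves all its
-- weight to column 0, and an identity is left in the lower right.
detℤ-sumRow : ∀ {n} (w : Fin (suc n) → ℤ) (M : Matrix (suc n)) → (∀ c → M zero c ≡ w c) →
              (∀ r c → M (suc r) c ≡ δᶠ (suc r) c - δᶠ zero c) → detℤ M ≡ sum w
detℤ-sumRow {n} w M M₀ M₊ = begin
  detℤ M       ≡⟨ detℤ-addRows zero suc (λ p → - w (suc p)) N M (λ p ()) others first ⟨
  detℤ N       ≡⟨ detℤ-row₀ N (λ c → refl) ⟩
  sum w * detℤ (λ r c → δᶠ {n} r c - 0ℤ)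
               ≡⟨ cong (sum w *_) (trans (detℤ-cong λ r c → +-identityʳ (δᶠ {n} r c)) (detℤ-identity n)) ⟩
  sum w * 1ℤ   ≡⟨ *-identityʳ (sum w) ⟩
  sum w        ∎
  where
  open ≡-Reasoning
  N : Matrix (suc n)
  N zero    zero    = sum w
  N zero    (suc c) = 0ℤ
  N (suc r) c       = δᶠ (suc r) c - δᶠ zero c
  others : ∀ r → r ≢ zero → ∀ c → N r c ≡ M r c
  others zero    r≢0 c = contradiction refl r≢0
  others (suc r) r≢0 c = sym (M₊ r c)
  neg : ∀ a → a ≡ - a * (0ℤ - 1ℤ)
  neg = solve-∀
  first : ∀ c → N zero c ≡ M zero c + sum λ p → - w (suc p) * M (suc p) c
  first zero    = cong₂ _+_ (sym (M₀ zero)) (sum-cong-≗ λ p →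
    trans (neg (w (suc p))) (cong (- w (suc p) *_) (sym (M₊ p zero))))
  first (suc c) = begin
    0ℤ                                             ≡⟨ +-inverseʳ (w (suc c)) ⟨
    w (suc c) + - w (suc c)                        ≡⟨ cong₂ _+_ (M₀ (suc c)) (sum-δ (λ p → - w (suc p)) c) ⟨
    M zero (suc c) + sum (λ p → - w (suc p) * δᶠ p c)
      ≡⟨ cong (_+_ (M zero (suc c))) (sum-cong-≗ λ p →
           cong (- w (suc p) *_) (trans (sym (+-identityʳ (δᶠ p c))) (sym (M₊ p (suc c))))) ⟩
    M zero (suc c) + sum (λ p → - w (suc p) * M (suc p) (suc c)) ∎

-- Subtracting row 0 from the other rows of I + cJ gives the shape of `detℤ-sumRow`, so the value is
-- the sum of row 0.
detℤ-identity+const : ∀ n c → detℤ {n} (λ i j → δᶠ i j + c) ≡ 1ℤ + + n * c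
detℤ-identity+const zero    c = refl
detℤ-identity+const (suc n) c = trans
  (sym (detℤ-eliminate (λ _ → zero) k N (λ i j → δᶠ i j + c) (λ _ → refl) eq))
  (trans (detℤ-sumRow (λ j → δᶠ zero j + c) N (λ _ → refl) (λ r c → refl))
    (trans (cong (_+_ (1ℤ + c)) (trans (sum-cong-≗ {n = n} (λ _ → +-identityˡ c)) (sum-const n c))) (lemma c (+ n))))
  where
  k : Fin (suc n) → ℤ
  k zero    = 0ℤ
  k (suc _) = -1ℤ
  N : Matrix (suc n)
  N zero    j = δᶠ zero j + c
  N (suc i) j = δᶠ (suc i) j - δᶠ zero j
  difference : ∀ a b c → a - b ≡ (a + c) + -1ℤ * (b + c)
  difference = solve-∀
  eq : ∀ i j → N i j ≡ (δᶠ i j + c) + k i * (δᶠ zero j + c)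
  eq zero    j = sym (+-identityʳ (δᶠ zero j + c))
  eq (suc i) j = difference (δᶠ (suc i) j) (δᶠ zero j) c
  lemma : ∀ c n → 1ℤ + c + n * c ≡ 1ℤ + (1ℤ + n) * c
  lemma = solve-∀

-- Determinants indexed by a finite type

Det : ∀ {n} {I : Set} → Fin n ↔ I → (I → I → ℤ) → ℤ
Det e M = detℤ λ u v → M (to e u) (to e v)

infixr 4 _⊎ᶠ_
_⊎ᶠ_ : ∀ {m n} {I J : Set} → Fin m ↔ I → Fin n ↔ J → Fin (m ℕ.+ n) ↔ (I ⊎ J)
_⊎ᶠ_ {m} {n} e f = (e ⊎-↔ f) ↔-∘ +↔⊎ {m} {n}

module _ {n} {I : Set} (e : Fin n ↔ I) where

  Det-cong : {A B : I → I → ℤ} → (∀ i j → A i j ≡ B i j) → Det e A ≡ Det e B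
  Det-cong eq = detℤ-cong λ u v → eq (to e u) (to e v)

  -- With indices transported along `e`, a row operation can be specified by pattern matching on the
  -- kind of vertex.
  Det-eliminate : (l : I → I) (k : I → ℤ) (A B : I → I → ℤ) → (∀ i → k (l i) ≡ 0ℤ) →
                  (∀ i j → A i j ≡ B i j + k i * B (l i) j) → Det e A ≡ Det e B
  Det-eliminate l k A B kl≡0 eq = detℤ-eliminate (from e ∘ l ∘ to e) (k ∘ to e) _ _
    (λ u → trans (cong k (strictlyInverseˡ e (l (to e u)))) (kl≡0 (to e u)))
    (λ u v → trans (eq (to e u) (to e v))
      (cong (λ i → B (to e u) (to e v) + k (to e u) * B i (to e v)) (sym (strictlyInverseˡ e (l (to e u))))))

  Det-scale : (y : ℤ) (d : I → ℕ) (A B : I → I → ℤ) → (∀ i j → A i j ≡ y ^ d i * B i j) →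
              Det e A ≡ y ^ sumℕ (d ∘ to e) * Det e B
  Det-scale y d A B eq = detℤ-scale y (d ∘ to e) _ (λ u v → B (to e u) (to e v)) λ u v → eq (to e u) (to e v)

  Det-addRows : ∀ {m} (i : I) (l : Fin m → I) (k : Fin m → ℤ) (A B : I → I → ℤ) →
                (∀ p → i ≢ l p) → (∀ r → r ≢ i → ∀ j → A r j ≡ B r j) →
                (∀ j → A i j ≡ B i j + sum λ p → k p * B (l p) j) → Det e A ≡ Det e B
  Det-addRows i l k A B i≢l A≡B eq = detℤ-addRows (from e i) (from e ∘ l) k _ _
    (λ p eq′ → i≢l p (trans (sym (strictlyInverseˡ e i)) (trans (cong (to e) eq′) (strictlyInverseˡ e (l p)))))
    (λ u u≢i v → A≡B (to e u) (λ eq′ → u≢i (trans (sym (strictlyInverseʳ e u)) (cong (from e) eq′))) (to e v))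
    (λ v → trans (cong (λ r → A r (to e v)) (strictlyInverseˡ e i)) (trans (eq (to e v))
      (cong₂ _+_ (cong (λ r → B r (to e v)) (sym (strictlyInverseˡ e i)))
        (sum-cong-≗ λ p → cong (λ r → k p * B r (to e v)) (sym (strictlyInverseˡ e (l p)))))))

  does-transport : (_≟_ : DecidableEquality I) → ∀ u v → does (to e u ≟ to e v) ≡ does (u Fin.≟ v)
  does-transport _≟_ u v = does-⇔
    (mk⇔ (λ eq → trans (sym (strictlyInverseʳ e u)) (trans (cong (from e) eq) (strictlyInverseʳ e v))) (cong (to e)))
    (to e u ≟ to e v) (u Fin.≟ v)

  δ-transport : (_≟_ : DecidableEquality I) → ∀ u v → δ _≟_ (to e u) (to e v) ≡ δᶠ u v
  δ-transport _≟_ u v = cong (if_then 1ℤ else 0ℤ) (does-transport _≟_ u v)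

  Det-identity+const : (_≟_ : DecidableEquality I) → ∀ c → Det e (λ i j → δ _≟_ i j + c) ≡ 1ℤ + + n * c
  Det-identity+const _≟_ c = trans (detℤ-cong λ u v → cong (_+ c) (δ-transport _≟_ u v)) (detℤ-identity+const n c)

module _ {m n} {I J : Set} (e : Fin m ↔ I) (f : Fin n ↔ J) where

  to-↑ˡ : ∀ u → to (e ⊎ᶠ f) (u ↑ˡ n) ≡ inj₁ (to e u)
  to-↑ˡ u = cong (Sum.map (to e) (to f)) (splitAt-↑ˡ m u n)

  to-↑ʳ : ∀ v → to (e ⊎ᶠ f) (m ↑ʳ v) ≡ inj₂ (to f v)
  to-↑ʳ v = cong (Sum.map (to e) (to f)) (splitAt-↑ʳ m n v)

  Det-lowerBlock : (M : I ⊎ J → I ⊎ J → ℤ) → (∀ i j → M (inj₁ i) (inj₂ j) ≡ 0ℤ) →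
    Det (e ⊎ᶠ f) M ≡ Det e (λ i j → M (inj₁ i) (inj₁ j)) * Det f (λ i j → M (inj₂ i) (inj₂ j))
  Det-lowerBlock M eq = trans
    (detℤ-block m _ λ u v → trans (cong₂ M (to-↑ˡ u) (to-↑ʳ v)) (eq (to e u) (to f v)))
    (cong₂ _*_ (detℤ-cong λ u v → cong₂ M (to-↑ˡ u) (to-↑ˡ v))
               (detℤ-cong λ u v → cong₂ M (to-↑ʳ u) (to-↑ʳ v)))

Det-upperBlock : ∀ {m n} {I J : Set} (e : Fin m ↔ I) (f : Fin n ↔ J) (M : I ⊎ J → I ⊎ J → ℤ) →
  (∀ i j → M (inj₂ j) (inj₁ i) ≡ 0ℤ) →
  Det (e ⊎ᶠ f) M ≡ Det e (λ i j → M (inj₁ i) (inj₁ j)) * Det f (λ i j → M (inj₂ i) (inj₂ j))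
Det-upperBlock e f M eq = trans (sym (detℤ-transpose (λ u v → M (to (e ⊎ᶠ f) u) (to (e ⊎ᶠ f) v))))
  (trans (Det-lowerBlock e f (flip M) eq)
    (cong₂ _*_ (detℤ-transpose (λ u v → M (inj₁ (to e u)) (inj₁ (to e v))))
               (detℤ-transpose (λ u v → M (inj₂ (to f u)) (inj₂ (to f v))))))

-- Evaluation of the characteristic polynomial

eval : ℤ → Poly → ℤ
eval x []      = 0ℤ
eval x (a ∷ p) = a + x * eval x p

eval-⊕ : ∀ x p q → eval x (p ⊕ q) ≡ eval x p + eval x q
eval-⊕ x []      q       = sym (+-identityˡ _)
eval-⊕ x (a ∷ p) []      = sym (+-identityʳ _)
eval-⊕ x (a ∷ p) (b ∷ q) = trans (cong (λ z → a + b + x * z) (eval-⊕ x p q)) (lemma a b x (eval x p) (eval x q))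
  where
  lemma : ∀ a b x p q → a + b + x * (p + q) ≡ a + x * p + (b + x * q)
  lemma = solve-∀

eval-scale : ∀ x c p → eval x (scale c p) ≡ c * eval x p
eval-scale x c []      = sym (*-zeroʳ c)
eval-scale x c (a ∷ p) = trans (cong (λ z → c * a + x * z) (eval-scale x c p)) (lemma c a x (eval x p))
  where
  lemma : ∀ c a x p → c * a + x * (c * p) ≡ c * (a + x * p)
  lemma = solve-∀

eval-⊗ : ∀ x p q → eval x (p ⊗ q) ≡ eval x p * eval x q
eval-⊗ x []      q = refl
eval-⊗ x (a ∷ p) q = begin
  eval x (scale a q ⊕ (0ℤ ∷ (p ⊗ q)))             ≡⟨ eval-⊕ x (scale a q) (0ℤ ∷ (p ⊗ q)) ⟩
  eval x (scale a q) + (0ℤ + x * eval x (p ⊗ q))  ≡⟨ cong₂ (λ y z → y + (0ℤ + x * z)) (eval-scale x a q) (eval-⊗ x p q) ⟩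
  a * eval x q + (0ℤ + x * (eval x p * eval x q)) ≡⟨ lemma a x (eval x p) (eval x q) ⟩
  (a + x * eval x p) * eval x q                   ∎
  where
  open ≡-Reasoning
  lemma : ∀ a x p q → a * q + (0ℤ + x * (p * q)) ≡ (a + x * p) * q
  lemma = solve-∀

eval-signP : ∀ x k p → eval x (signP k p) ≡ sign k * eval x p
eval-signP x zero          p = sym (*-identityˡ _)
eval-signP x (suc zero)    p = eval-scale x -1ℤ p
eval-signP x (suc (suc k)) p = trans (eval-signP x k p) (cong (_* eval x p) (sym (neg-involutive (sign k))))

eval-sumFin : ∀ x n (f : Fin n → Poly) → eval x (sumFin n f) ≡ sum (eval x ∘ f)
eval-sumFin x zero    f = refl
eval-sumFin x (suc n) f = trans (eval-⊕ x (f zero) (sumFin n (f ∘ suc)))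
  (cong (_+_ (eval x (f zero))) (eval-sumFin x n (f ∘ suc)))

eval-det : ∀ x n M → eval x (det n M) ≡ detℤ (λ r c → eval x (M r c))
eval-det x zero    M = trans (cong (_+_ 1ℤ) (*-zeroʳ x)) refl
eval-det x (suc n) M = trans
  (eval-sumFin x (suc n) λ j → signP (toℕ j) (M zero j ⊗ det n (M′ j)))
  (sum-cong-≗ λ j → trans
    (eval-signP x (toℕ j) (M zero j ⊗ det n (M′ j)))
    (cong (sign (toℕ j) *_) (trans
      (eval-⊗ x (M zero j) (det n (M′ j)))
      (cong (eval x (M zero j) *_) (eval-det x n (M′ j))))))
  where
  M′ : Fin (suc n) → Fin n → Fin n → Poly
  M′ j r c = M (suc r) (punchIn j c)

eval-coeff≡0 : ∀ x p → (∀ i → coeff p i ≡ 0ℤ) → eval x p ≡ 0ℤ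
eval-coeff≡0 x []      eq = refl
eval-coeff≡0 x (a ∷ p) eq = trans (cong₂ (λ y z → y + x * z) (eq zero) (eval-coeff≡0 x p (eq ∘ suc)))
  (trans (+-identityˡ _) (*-zeroʳ x))

eval-coeff : ∀ x p q → (∀ i → coeff p i ≡ coeff q i) → eval x p ≡ eval x q
eval-coeff x []      q       eq = sym (eval-coeff≡0 x q (sym ∘ eq))
eval-coeff x (a ∷ p) []      eq = eval-coeff≡0 x (a ∷ p) eq
eval-coeff x (a ∷ p) (b ∷ q) eq = cong₂ (λ y z → y + x * z) (eq zero) (eval-coeff x p q (eq ∘ suc))

-- The matrix xI - bD. With x = -1 and b = 2 its determinant is 2^n φ(-1/2), an integer.
pencil : (G : Graph) → ℤ → ℤ → Matrix (order G)
pencil G x b u v = x * δᶠ u v - b * + dist G u v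

eval-charPolyD : ∀ G x → eval x (charPolyD G) ≡ detℤ (pencil G x 1ℤ)
eval-charPolyD G x = trans (eval-det x (order G) λ u v → (if u ==ᶠ v then X else []) ⊕ negP (constP (distMatrix G u v))) (detℤ-cong λ u v → begin
  eval x ((if u ==ᶠ v then X else []) ⊕ negP (constP (+ dist G u v)))
    ≡⟨ eval-⊕ x (if u ==ᶠ v then X else []) _ ⟩
  eval x (if u ==ᶠ v then X else []) + (-1ℤ * (+ dist G u v) + x * 0ℤ)
    ≡⟨ cong₂ _+_ (trans (cong (λ b → eval x (if b then X else [])) (isYes≗does (u Fin.≟ v)))
                        (diagonal (does (u Fin.≟ v))))
                 (constant x (+ dist G u v)) ⟩
  x * δᶠ u v - 1ℤ * + dist G u v ∎)
  where
  open ≡-Reasoning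
  constant : ∀ x d → -1ℤ * d + x * 0ℤ ≡ - (1ℤ * d)
  constant = solve-∀
  variable-X : ∀ x → 0ℤ + x * (1ℤ + x * 0ℤ) ≡ x * 1ℤ
  variable-X = solve-∀
  diagonal : ∀ b → eval x (if b then X else []) ≡ x * (if b then 1ℤ else 0ℤ)
  diagonal true  = variable-X x
  diagonal false = sym (*-zeroʳ x)

-- The value at -1/2 through congruences

equal-mod-odd : ∀ a b → (∀ k → + suc (2 ℕ.* k) ∣ a - b) → a ≡ b
-- For k = |a - b| the modulus 2k + 1 exceeds |a - b|, so divisibility forces the difference to be
-- 0.
equal-mod-odd a b m∣ = i-j≡0⇒i≡j a b (∣i∣≡0⇒i≡0 (small ∣ a - b ∣ (∣⇒∣ᵤ (m∣ ∣ a - b ∣))))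
  where
  small : ∀ n → suc (2 ℕ.* n) ℕ.∣ n → n ≡ 0
  small zero    _  = refl
  small (suc n) m∣ = contradiction (ℕ.∣⇒≤ m∣) (ℕ.<⇒≱ (ℕ.s≤s (ℕ.m≤m+n (suc n) _)))

sumℕ-ones : ∀ n → sumℕ {n} (λ _ → 1) ≡ n
sumℕ-ones zero    = refl
sumℕ-ones (suc n) = cong suc (sumℕ-ones n)

cospectral⇒det : ∀ {G H} → DCospectral G H → ∀ x → detℤ (pencil G x 1ℤ) ≡ detℤ (pencil H x 1ℤ)
cospectral⇒det {G} {H} (_ , coeffs) x =
  trans (sym (eval-charPolyD G x)) (trans (eval-coeff x (charPolyD G) (charPolyD H) coeffs) (eval-charPolyD H x))

-- Since 2k ≡ -1, the matrices 2(kI - D) and -I - 2D agree entrywise modulo 2k + 1.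
detℤ-pencil-mod : ∀ G k →
  + suc (2 ℕ.* k) ∣ (+ 2) ^ order G * detℤ (pencil G (+ k) 1ℤ) - detℤ (pencil G -1ℤ (+ 2))
detℤ-pencil-mod G k = subst (λ z → + suc (2 ℕ.* k) ∣ z - detℤ (pencil G -1ℤ (+ 2)))
  (trans (detℤ-scale (+ 2) (λ _ → 1) (pencil G (+ 2 * + k) (+ 2)) (pencil G (+ k) 1ℤ)
           (λ u v → doubled (+ k) (δᶠ u v) (+ dist G u v)))
         (cong (λ n → (+ 2) ^ n * detℤ (pencil G (+ k) 1ℤ)) (sumℕ-ones (order G))))
  (detℤ-mod _ (pencil G (+ 2 * + k) (+ 2)) (pencil G -1ℤ (+ 2)) λ u v →
    divides (δᶠ u v) (sym (trans (cong (λ z → δᶠ u v * (1ℤ + z)) (pos-* 2 k))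
      (difference (+ k) (δᶠ u v) (+ 2 * + dist G u v)))))
  where
  doubled : ∀ k δ d → + 2 * k * δ - + 2 * d ≡ + 2 * 1ℤ * (k * δ - 1ℤ * d)
  doubled = solve-∀
  difference : ∀ k δ d → δ * (1ℤ + + 2 * k) ≡ (+ 2 * k * δ - d) - (-1ℤ * δ - d)
  difference = solve-∀

-- Both sides are 2 ^ n times a characteristic polynomial at -1/2: modulo
-- 2k + 1 the integer k plays the role of -1/2.
cospectral⇒det-½ : ∀ {G H} → DCospectral G H → detℤ (pencil G -1ℤ (+ 2)) ≡ detℤ (pencil H -1ℤ (+ 2))
cospectral⇒det-½ {G} {H} cospectral@(order≡ , _) = equal-mod-odd g h λ k →
  subst (+ suc (2 ℕ.* k) ∣_) (telescope ((+ 2) ^ order G * detℤ (pencil G (+ k) 1ℤ)) g h)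
    (∣m∣n⇒∣m+n (∣m⇒∣m*n -1ℤ (detℤ-pencil-mod G k))
      (subst₂ (λ n d → + suc (2 ℕ.* k) ∣ (+ 2) ^ n * d - h)
        (sym order≡) (sym (cospectral⇒det cospectral (+ k))) (detℤ-pencil-mod H k)))
  where
  g = detℤ (pencil G -1ℤ (+ 2))
  h = detℤ (pencil H -1ℤ (+ 2))
  telescope : ∀ p a b → (p - a) * -1ℤ + (p - b) ≡ a - b
  telescope = solve-∀

-- Lets a closed formula `D` on a structured vertex type replace the distances found by search.
Det-pencil : ∀ {I : Set} G (e : Fin (order G) ↔ I) (_≟_ : DecidableEquality I) (D : I → I → ℤ) →
             (∀ i j → + dist G (from e i) (from e j) ≡ D i j) → ∀ x b →
             detℤ (pencil G x b) ≡ Det e (λ i j → x * δ _≟_ i j - b * D i j)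
Det-pencil G e _≟_ D dist≡D x b = detℤ-cong λ u v → cong₂ (λ p q → x * p - b * q)
  (sym (δ-transport e _≟_ u v))
  (trans (cong₂ (λ u v → + dist G u v) (sym (strictlyInverseʳ e u)) (sym (strictlyInverseʳ e v)))
         (dist≡D (to e u) (to e v)))

-- Distances of at most three

anyFin-true : ∀ n (f : Fin n → Bool) i → f i ≡ true → anyFin n f ≡ true
anyFin-true (suc n) f zero    fi = cong (_∨ anyFin n (f ∘ suc)) fi
anyFin-true (suc n) f (suc i) fi = trans (cong (f zero ∨_) (anyFin-true n (f ∘ suc) i fi)) (∨-zeroʳ (f zero))

anyFin-false : ∀ n (f : Fin n → Bool) → (∀ i → f i ≡ false) → anyFin n f ≡ false
anyFin-false zero    f f≡false = refl
anyFin-false (suc n) f f≡false = cong₂ _∨_ (f≡false zero) (anyFin-false n (f ∘ suc) (f≡false ∘ suc))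

-- The bound `3 ≤ order G` gives the search enough fuel for distance 3, the largest that occurs in
-- either graph.
module Distances {V : Set} (G : Graph) (e : Fin (order G) ↔ V) (_~_ : V → V → Bool)
                 (adj≡ : ∀ u v → adj G u v ≡ (to e u ~ to e v)) (3≤n : 3 ℕ.≤ order G) where

  private
    R : ℕ → V → V → Bool
    R k x y = reach G k (from e x) (from e y)

    R-refl : ∀ x → R 0 x x ≡ true
    R-refl x = trans (isYes≗does (from e x Fin.≟ from e x)) (dec-true (from e x Fin.≟ from e x) refl)

    R-irrefl : ∀ {x y} → x ≢ y → R 0 x y ≡ false
    R-irrefl {x} {y} x≢y = trans (isYes≗does (from e x Fin.≟ from e y)) (dec-false (from e x Fin.≟ from e y)
      λ eq → x≢y (trans (sym (strictlyInverseˡ e x)) (trans (cong (to e) eq) (strictlyInverseˡ e y))))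

    R-step : ∀ k {x y} z → (x ~ z) ≡ true → R k z y ≡ true → R (suc k) x y ≡ true
    R-step k {x} {y} z x~z zRy = trans
      (cong (R k x y ∨_) (anyFin-true (order G) _ (from e z)
        (cong₂ _∧_ (trans (adj≡ (from e x) (from e z))
          (trans (cong₂ _~_ (strictlyInverseˡ e x) (strictlyInverseˡ e z)) x~z)) zRy)))
      (∨-zeroʳ (R k x y))

    R-stop : ∀ k {x y} → R k x y ≡ false → (∀ z → (x ~ z) ≡ true → R k z y ≡ false) → R (suc k) x y ≡ false
    R-stop k {x} {y} ¬xRy stop = cong₂ _∨_ ¬xRy (anyFin-false (order G) _ λ w → no-step w (x ~ to e w) refl)
      where
      no-step : ∀ w b → (x ~ to e w) ≡ b → (adj G (from e x) w ∧ reach G k w (from e y)) ≡ false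
      no-step w b eq with adj-w ← trans (adj≡ (from e x) w) (trans (cong (_~ to e w) (strictlyInverseˡ e x)) eq) with b
      ... | false = cong (_∧ reach G k w (from e y)) adj-w
      ... | true  = cong₂ _∧_ adj-w (trans (cong (λ u → reach G k u (from e y)) (sym (strictlyInverseʳ e w))) (stop (to e w) eq))

    R-down : ∀ k {x y} → R (suc k) x y ≡ false → R k x y ≡ false
    R-down k {x} {y} eq with R k x y
    ... | false = refl

    R₁-irrefl : ∀ {x y} → x ≢ y → (x ~ y) ≡ false → R 1 x y ≡ false
    R₁-irrefl {x} x≢y x≁y = R-stop 0 (R-irrefl x≢y) λ z x~z → R-irrefl λ where
      refl → contradiction (trans (sym x~z) x≁y) λ ()

    -- `j` counts the misses after the one at level `k`.
    search : ∀ {u v} k j fuel → suc j ℕ.≤ fuel → reach G (j ℕ.+ k) u v ≡ false → reach G (suc (j ℕ.+ k)) u v ≡ true →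
             (∀ i → i ℕ.≤ j ℕ.+ k → reach G i u v ≡ false) → distSearch G u v k fuel ≡ suc (j ℕ.+ k)
    -- When the fuel runs out, the search answers `suc k` untested, which is already the right
    -- value.
    search {u} {v} k zero    (suc zero)       j<f miss hit below rewrite miss = refl
    search {u} {v} k zero    (suc (suc fuel)) j<f miss hit below rewrite miss | hit = refl
    search {u} {v} k (suc j) (suc fuel) (ℕ.s≤s j<f) miss hit below
      rewrite below k (ℕ.m≤n+m k (suc j)) = trans
        (search (suc k) j fuel j<f
          (subst (λ d → reach G d u v ≡ false) (sym (ℕ.+-suc j k)) miss)
          (subst (λ d → reach G (suc d) u v ≡ true) (sym (ℕ.+-suc j k)) hit)
          (subst (λ d → ∀ i → i ℕ.≤ d → reach G i u v ≡ false) (sym (ℕ.+-suc j k)) below))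
        (cong suc (ℕ.+-suc j k))

    exact : ∀ d {x y} → suc d ℕ.≤ order G → R d x y ≡ false → R (suc d) x y ≡ true → dist G (from e x) (from e y) ≡ suc d
    exact d d<n miss hit = trans
      (search 0 d (order G) d<n (subst (λ k → reach G k _ _ ≡ false) d≡ miss) (subst (λ k → reach G (suc k) _ _ ≡ true) d≡ hit)
        (λ i i≤d → down i d (subst (i ℕ.≤_) (sym d≡) i≤d) miss))
      (cong suc (sym d≡))
      where
      d≡ = sym (ℕ.+-identityʳ d)
      down : ∀ i d {x y} → i ℕ.≤ d → R d x y ≡ false → R i x y ≡ false
      down i d i≤d miss with ℕ.m≤n⇒m<n∨m≡n i≤d
      down i d       i≤d miss | inj₂ refl = miss
      down i (suc d) i≤d miss | inj₁ (ℕ.s≤s i≤d′) = down i d i≤d′ (R-down d miss)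

  dist≡0 : ∀ x → dist G (from e x) (from e x) ≡ 0
  dist≡0 x = immediate (order G)
    where
    immediate : ∀ fuel → distSearch G (from e x) (from e x) 0 fuel ≡ 0
    immediate zero       = refl
    immediate (suc fuel) = cong (if_then 0 else distSearch G (from e x) (from e x) 1 fuel) (R-refl x)

  dist≡1 : ∀ {x y} → x ≢ y → (x ~ y) ≡ true → dist G (from e x) (from e y) ≡ 1
  dist≡1 {y = y} x≢y x~y = exact 0 (ℕ.≤-trans (ℕ.s≤s ℕ.z≤n) 3≤n) (R-irrefl x≢y) (R-step 0 y x~y (R-refl y))

  dist≡2 : ∀ {x y} z → x ≢ y → (x ~ y) ≡ false → (x ~ z) ≡ true → (z ~ y) ≡ true → dist G (from e x) (from e y) ≡ 2
  dist≡2 {y = y} z x≢y x≁y x~z z~y = exact 1 (ℕ.≤-trans (ℕ.s≤s (ℕ.s≤s ℕ.z≤n)) 3≤n) (R₁-irrefl x≢y x≁y)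
    (R-step 1 z x~z (R-step 0 y z~y (R-refl y)))

  dist≡3 : ∀ {x y} z w → x ≢ y → (x ~ y) ≡ false → (∀ z → (x ~ z) ≡ true → z ≢ y × (z ~ y) ≡ false) →
           (x ~ z) ≡ true → (z ~ w) ≡ true → (w ~ y) ≡ true → dist G (from e x) (from e y) ≡ 3
  dist≡3 {y = y} z w x≢y x≁y no-common x~z z~w w~y = exact 2 3≤n
    (R-stop 1 (R₁-irrefl x≢y x≁y) λ z x~z → let z≢y , z≁y = no-common z x~z in R₁-irrefl z≢y z≁y)
    (R-step 2 z x~z (R-step 1 w z~w (R-step 0 y w~y (R-refl y))))

-- The graph K_n^{n_1,…,n_k}

sumℕ-split : ∀ m {n} (f : Fin (m ℕ.+ n) → ℕ) → sumℕ f ≡ sumℕ (f ∘ (_↑ˡ n)) ℕ.+ sumℕ (f ∘ (m ↑ʳ_))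
sumℕ-split zero    f = refl
sumℕ-split (suc m) f = trans (cong (f zero ℕ.+_) (sumℕ-split m (f ∘ suc))) (sym (ℕ.+-assoc (f zero) _ _))

sumℕ-⊎ : ∀ {m n} {I J : Set} (e : Fin m ↔ I) (f : Fin n ↔ J) (g : I ⊎ J → ℕ) →
         sumℕ (g ∘ to (e ⊎ᶠ f)) ≡ sumℕ (g ∘ inj₁ ∘ to e) ℕ.+ sumℕ (g ∘ inj₂ ∘ to f)
sumℕ-⊎ {m} e f g = trans (sumℕ-split m (g ∘ to (e ⊎ᶠ f))) (cong₂ ℕ._+_
  (sumℕ-cong λ u → cong g (to-↑ˡ e f u)) (sumℕ-cong λ v → cong g (to-↑ʳ e f v)))

sumℕ-zero : ∀ n → sumℕ {n} (λ _ → 0) ≡ 0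
sumℕ-zero zero    = refl
sumℕ-zero (suc n) = sumℕ-zero n

-- Nested sums follow the recursion of `blockOf`, so statements about all blocks go by induction on
-- the list.
Block : List ℕ → Set
Block []       = Fin 0
Block (a ∷ as) = Fin a ⊎ Block as

blocks : ∀ ns → Fin (sumL ns) ↔ Block ns
blocks []       = ↔-id (Fin 0)
blocks (a ∷ as) = ↔-id (Fin a) ⊎ᶠ blocks as

_≟ᵇ_ : ∀ {ns} → DecidableEquality (Block ns)
_≟ᵇ_ {[]}     = Fin._≟_
_≟ᵇ_ {a ∷ as} = ≡-dec Fin._≟_ _≟ᵇ_

block# : ∀ ns → Block ns → ℕ
block# (a ∷ as) (inj₁ _) = 0
block# (a ∷ as) (inj₂ q) = suc (block# as q)

blockOf-↑ˡ : ∀ a as (p : Fin a) → blockOf (a ∷ as) (toℕ p) ≡ 0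
blockOf-↑ˡ (suc a) as zero    = refl
blockOf-↑ˡ (suc a) as (suc p) = blockOf-↑ˡ a as p

blockOf-↑ʳ : ∀ a as j → blockOf (a ∷ as) (a ℕ.+ j) ≡ suc (blockOf as j)
blockOf-↑ʳ zero    as j = refl
blockOf-↑ʳ (suc a) as j = blockOf-↑ʳ a as j

blockOf-block# : ∀ ns i → blockOf ns (toℕ i) ≡ block# ns (to (blocks ns) i)
blockOf-block# (a ∷ as) i with splitAt a i in eq
... | inj₁ p = trans (cong (blockOf (a ∷ as)) (trans (cong toℕ (sym (splitAt⁻¹-↑ˡ eq))) (toℕ-↑ˡ p (sumL as)))) (blockOf-↑ˡ a as p)
... | inj₂ q = trans (cong (blockOf (a ∷ as)) (trans (cong toℕ (sym (splitAt⁻¹-↑ʳ {m = a} eq))) (toℕ-↑ʳ a q)))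
  (trans (blockOf-↑ʳ a as (toℕ q)) (cong suc (blockOf-block# as q)))

-- The direct sum of the all-ones matrices of the blocks, diagonal included. Writing T for it, the
-- distance matrix without the centre is 2J - T - I.
together : ∀ ns → Block ns → Block ns → ℤ
together ns i j = δ ℕ._≟_ (block# ns i) (block# ns j)

-- The matrix is block diagonal, and a block of size a contributes det(I + 2J) = 1 + 2a.
Det-together : ∀ ns → Det (blocks ns) (λ i j → δ _≟ᵇ_ i j + + 2 * together ns i j) ≡ + product (map (λ n → suc (2 ℕ.* n)) ns)
Det-together []       = refl
Det-together (a ∷ as) = begin
  Det (blocks (a ∷ as)) (λ i j → δ _≟ᵇ_ i j + + 2 * together (a ∷ as) i j)
    ≡⟨ Det-lowerBlock (↔-id (Fin a)) (blocks as) (λ i j → δ _≟ᵇ_ i j + + 2 * together (a ∷ as) i j) (λ p q → refl) ⟩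
  detℤ {a} (λ p q → δᶠ p q + + 2) * Det (blocks as) (λ i j → δ _≟ᵇ_ i j + + 2 * together as i j)
    ≡⟨ cong₂ _*_ (trans (detℤ-identity+const a (+ 2)) (cong (_+_ 1ℤ) (trans (sym (pos-* a 2)) (cong +_ (ℕ.*-comm a 2))))) (Det-together as) ⟩
  + suc (2 ℕ.* a) * + product (map (λ n → suc (2 ℕ.* n)) as)
    ≡⟨ pos-* (suc (2 ℕ.* a)) _ ⟨
  + product (map (λ n → suc (2 ℕ.* n)) (a ∷ as)) ∎
  where open ≡-Reasoning

-- The argument only witnesses that the block is nonempty.
first : ∀ {a} → Fin a → Fin a
first {suc a} _ = zero

notFirst : ∀ {a} → Fin a → Bool
notFirst zero    = false
notFirst (suc _) = true

leader : ∀ ns → Block ns → Block ns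
leader (a ∷ as) (inj₁ p) = inj₁ (first p)
leader (a ∷ as) (inj₂ q) = inj₂ (leader as q)

follows : ∀ ns → Block ns → Bool
follows (a ∷ as) (inj₁ p) = notFirst p
follows (a ∷ as) (inj₂ q) = follows as q

block#-leader : ∀ ns i → block# ns (leader ns i) ≡ block# ns i
block#-leader (a ∷ as) (inj₁ p) = refl
block#-leader (a ∷ as) (inj₂ q) = cong suc (block#-leader as q)

follows-leader : ∀ ns i → follows ns (leader ns i) ≡ false
follows-leader (suc a ∷ as) (inj₁ p) = refl
follows-leader (a ∷ as)     (inj₂ q) = follows-leader as q

-- For positive block sizes this is N - k: a block of size a has a - 1 vertices besides its leader.
excess : List ℕ → ℕ
excess ns = sumL (map ℕ.pred ns)

sumℕ-follows : ∀ ns → sumℕ (λ u → if follows ns (to (blocks ns) u) then 1 else 0) ≡ excess ns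
sumℕ-follows []       = refl
sumℕ-follows (a ∷ as) = trans
  (sumℕ-⊎ (↔-id (Fin a)) (blocks as) (λ i → if follows (a ∷ as) i then 1 else 0))
  (cong₂ ℕ._+_ (clique a) (sumℕ-follows as))
  where
  clique : ∀ a → sumℕ {a} (λ p → if notFirst p then 1 else 0) ≡ ℕ.pred a
  clique zero    = refl
  clique (suc a) = sumℕ-ones a

Hub : List ℕ → Set
Hub ns = Fin 1 ⊎ Block ns

hub : ∀ ns → Fin (suc (sumL ns)) ↔ Hub ns
hub ns = ↔-id (Fin 1) ⊎ᶠ blocks ns

_≟ʰ_ : ∀ {ns} → DecidableEquality (Hub ns)
_≟ʰ_ = ≡-dec Fin._≟_ _≟ᵇ_

hubAdj : ∀ ns → Hub ns → Hub ns → Bool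
hubAdj ns (inj₁ _) (inj₁ _) = false
hubAdj ns (inj₁ _) (inj₂ _) = true
hubAdj ns (inj₂ _) (inj₁ _) = true
hubAdj ns (inj₂ i) (inj₂ j) = not (does (i ≟ᵇ j)) ∧ does (block# ns i ℕ.≟ block# ns j)

hubAdj-correct : ∀ ns u v → adjKn ns u v ≡ hubAdj ns (to (hub ns) u) (to (hub ns) v)
hubAdj-correct ns zero    zero    = refl
hubAdj-correct ns zero    (suc v) = refl
hubAdj-correct ns (suc u) zero    = refl
hubAdj-correct ns (suc u) (suc v) = cong₂ _∧_
  (cong not (trans (isYes≗does (u Fin.≟ v)) (sym (does-transport (blocks ns) _≟ᵇ_ u v))))
  (trans (isYes≗does (blockOf ns (toℕ u) ℕ.≟ blockOf ns (toℕ v)))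
         (cong₂ (λ a b → does (a ℕ.≟ b)) (blockOf-block# ns u) (blockOf-block# ns v)))

hubDist : ∀ ns → Hub ns → Hub ns → ℤ
hubDist ns (inj₁ _) (inj₁ _) = 0ℤ
hubDist ns (inj₁ _) (inj₂ _) = 1ℤ
hubDist ns (inj₂ _) (inj₁ _) = 1ℤ
hubDist ns (inj₂ i) (inj₂ j) = + 2 - together ns i j - δ _≟ᵇ_ i j

module KnMatrix (ns : List ℕ) (2≤N : 2 ℕ.≤ sumL ns) where

  open Distances (Kn ns) (hub ns) (hubAdj ns) (hubAdj-correct ns) (ℕ.s≤s 2≤N)

  hubDist-correct : ∀ x y → + dist (Kn ns) (from (hub ns) x) (from (hub ns) y) ≡ hubDist ns x y
  hubDist-correct (inj₁ zero) (inj₁ zero) = cong +_ (dist≡0 (inj₁ zero))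
  hubDist-correct (inj₁ p)    (inj₂ j)    = cong +_ (dist≡1 {inj₁ p} {inj₂ j} (λ ()) refl)
  hubDist-correct (inj₂ i)    (inj₁ p)    = cong +_ (dist≡1 {inj₂ i} {inj₁ p} (λ ()) refl)
  hubDist-correct (inj₂ i)    (inj₂ j)    = within (i ≟ᵇ j) (block# ns i ℕ.≟ block# ns j)
    where
    within : Dec (i ≡ j) → Dec (block# ns i ≡ block# ns j) →
             + dist (Kn ns) (from (hub ns) (inj₂ i)) (from (hub ns) (inj₂ j)) ≡ hubDist ns (inj₂ i) (inj₂ j)
    within (yes refl) _ = trans (cong +_ (dist≡0 (inj₂ i))) (sym
        (cong₂ (λ t d → + 2 - t - d) (δ-equal ℕ._≟_ {block# ns i} refl) (δ-equal _≟ᵇ_ {i} refl)))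
    within (no i≢j) (yes same) = trans
        (cong +_ (dist≡1 (i≢j ∘ inj₂-injective) (cong₂ (λ a b → not a ∧ b) (dec-false (i ≟ᵇ j) i≢j) (dec-true (block# ns i ℕ.≟ block# ns j) same))))
        (sym (cong₂ (λ t d → + 2 - t - d) (δ-equal ℕ._≟_ same) (δ-distinct _≟ᵇ_ i≢j)))
    within (no i≢j) (no apart) = trans
        (cong +_ (dist≡2 (inj₁ zero) (i≢j ∘ inj₂-injective) (cong₂ (λ a b → not a ∧ b) (dec-false (i ≟ᵇ j) i≢j) (dec-false (block# ns i ℕ.≟ block# ns j) apart)) refl refl))
        (sym (cong₂ (λ t d → + 2 - t - d) (δ-distinct ℕ._≟_ apart) (δ-distinct _≟ᵇ_ i≢j)))

  private
    W : ℤ → ℤ → Hub ns → Hub ns → ℤ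
    W x b i j = x * δ _≟ʰ_ i j - b * hubDist ns i j

  -- In -I - 2D the hub row is -1 at the hub and -2 elsewhere, and the block part is I + 2T - 4J
  -- with T the matrix `together`. Subtracting twice the hub row removes -4J and clears the hub
  -- column at the same time.
  det-½-Kn : detℤ (pencil (Kn ns) -1ℤ (+ 2)) ≡ - + product (map (λ n → suc (2 ℕ.* n)) ns)
  det-½-Kn = begin
    detℤ (pencil (Kn ns) -1ℤ (+ 2))   ≡⟨ Det-pencil (Kn ns) (hub ns) _≟ʰ_ (hubDist ns) hubDist-correct -1ℤ (+ 2) ⟩
    Det (hub ns) (W -1ℤ (+ 2))        ≡⟨ Det-eliminate (hub ns) (λ _ → inj₁ zero) k A (W -1ℤ (+ 2)) (λ _ → refl) eq ⟨
    Det (hub ns) A                    ≡⟨ Det-upperBlock (↔-id (Fin 1)) (blocks ns) A (λ p j → refl) ⟩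
    -1ℤ * Det (blocks ns) (λ i j → δ _≟ᵇ_ i j + + 2 * together ns i j)
                                      ≡⟨ cong (-1ℤ *_) (Det-together ns) ⟩
    -1ℤ * + product (map (λ n → suc (2 ℕ.* n)) ns) ≡⟨ -1*i≡-i _ ⟩
    - + product (map (λ n → suc (2 ℕ.* n)) ns) ∎
    where
    open ≡-Reasoning
    k : Hub ns → ℤ
    k (inj₁ _) = 0ℤ
    k (inj₂ _) = - + 2
    A : Hub ns → Hub ns → ℤ
    A (inj₁ p) j        = W -1ℤ (+ 2) (inj₁ p) j
    A (inj₂ i) (inj₁ p) = 0ℤ
    A (inj₂ i) (inj₂ j) = δ _≟ᵇ_ i j + + 2 * together ns i j
    cleared : ∀ d t → d + + 2 * t ≡ -1ℤ * d - + 2 * (+ 2 - t - d) + - + 2 * (-1ℤ * 0ℤ - + 2 * 1ℤ)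
    cleared = solve-∀
    eq : ∀ i j → A i j ≡ W -1ℤ (+ 2) i j + k i * W -1ℤ (+ 2) (inj₁ zero) j
    eq (inj₁ p)    j           = sym (+-identityʳ (W -1ℤ (+ 2) (inj₁ p) j))
    eq (inj₂ i)    (inj₁ zero) = refl
    eq (inj₂ i)    (inj₂ j)    = cleared (δ _≟ᵇ_ i j) (together ns i j)

  -- Vertices of one block are adjacent twins, so subtracting the leader's row from a follower's
  -- leaves `y` times a difference of unit vectors. `sumℕ-follows` counts the followers.
  det-Kn-divisible : ∀ y → y ^ excess ns ∣ detℤ (pencil (Kn ns) (y - 1ℤ) 1ℤ)
  det-Kn-divisible y = subst (y ^ excess ns ∣_) (begin
    y ^ excess ns * Det (hub ns) B
      ≡⟨ cong (λ n → y ^ n * Det (hub ns) B) (sumℕ-follows ns) ⟨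
    y ^ sumℕ (d ∘ to (hub ns)) * Det (hub ns) B
      ≡⟨ Det-scale (hub ns) y d A B (λ i j → refl) ⟨
    Det (hub ns) A
      ≡⟨ Det-eliminate (hub ns) l k A W′ k-l eq ⟩
    Det (hub ns) W′
      ≡⟨ Det-pencil (Kn ns) (hub ns) _≟ʰ_ (hubDist ns) hubDist-correct (y - 1ℤ) 1ℤ ⟨
    detℤ (pencil (Kn ns) (y - 1ℤ) 1ℤ) ∎) (∣m⇒∣m*n (Det (hub ns) B) ∣-refl)
    where
    open ≡-Reasoning
    W′ = W (y - 1ℤ) 1ℤ
    l : Hub ns → Hub ns
    l (inj₁ p) = inj₁ p
    l (inj₂ i) = inj₂ (leader ns i)
    d : Hub ns → ℕ
    d (inj₁ _) = 0
    d (inj₂ i) = if follows ns i then 1 else 0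
    k : Hub ns → ℤ
    k (inj₁ _) = 0ℤ
    k (inj₂ i) = if follows ns i then -1ℤ else 0ℤ
    k-l : ∀ i → k (l i) ≡ 0ℤ
    k-l (inj₁ p) = refl
    k-l (inj₂ i) = cong (if_then -1ℤ else 0ℤ) (follows-leader ns i)
    B : Hub ns → Hub ns → ℤ
    B (inj₁ p) j = W′ (inj₁ p) j
    B (inj₂ i) j = if follows ns i then δ _≟ʰ_ (inj₂ i) j - δ _≟ʰ_ (inj₂ (leader ns i)) j else W′ (inj₂ i) j
    A : Hub ns → Hub ns → ℤ
    A i j = y ^ d i * B i j
    untouched : ∀ w v → 1ℤ * w ≡ w + 0ℤ * v
    untouched = solve-∀
    hub-column : ∀ y → y * 1ℤ * (0ℤ - 0ℤ) ≡ (y - 1ℤ) * 0ℤ - 1ℤ * 1ℤ + -1ℤ * ((y - 1ℤ) * 0ℤ - 1ℤ * 1ℤ)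
    hub-column = solve-∀
    block-column : ∀ y δ δ′ t → y * 1ℤ * (δ - δ′) ≡
      (y - 1ℤ) * δ - 1ℤ * (+ 2 - t - δ) + -1ℤ * ((y - 1ℤ) * δ′ - 1ℤ * (+ 2 - t - δ′))
    block-column = solve-∀
    eq : ∀ i j → A i j ≡ W′ i j + k i * W′ (l i) j
    eq (inj₁ p) j = untouched (W′ (inj₁ p) j) (W′ (inj₁ p) j)
    eq (inj₂ i) j with follows ns i
    eq (inj₂ i) j        | false = untouched (W′ (inj₂ i) j) (W′ (inj₂ (leader ns i)) j)
    eq (inj₂ i) (inj₁ p) | true  = hub-column y
    eq (inj₂ i) (inj₂ j) | true  = trans
      (block-column y (δ _≟ᵇ_ i j) (δ _≟ᵇ_ (leader ns i) j) (together ns i j))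
      -- The leader's row involves the leader's own block number, which is that of `i`.
      (cong (λ b → (y - 1ℤ) * δ _≟ᵇ_ i j - 1ℤ * (+ 2 - together ns i j - δ _≟ᵇ_ i j)
                   + -1ℤ * ((y - 1ℤ) * δ _≟ᵇ_ (leader ns i) j - 1ℤ * (+ 2 - δ ℕ._≟_ b (block# ns j) - δ _≟ᵇ_ (leader ns i) j)))
            (sym (block#-leader ns i)))

-- The graph K_s^t

pattern att i  = inj₁ (inj₁ i)
pattern free u = inj₁ (inj₂ u)
pattern pend j = inj₂ j

-- The s = t + r clique vertices, split into the `t` that carry a pendant and the `r` that do not.
Clique : ℕ → ℕ → Set
Clique t r = Fin t ⊎ Fin r

Vertex : ℕ → ℕ → Set
Vertex t r = Clique t r ⊎ Fin t

clique : ∀ t r → Fin (t ℕ.+ r) ↔ Clique t r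
clique t r = ↔-id (Fin t) ⊎ᶠ ↔-id (Fin r)

vertices : ∀ t r → Fin (t ℕ.+ r ℕ.+ t) ↔ Vertex t r
vertices t r = clique t r ⊎ᶠ ↔-id (Fin t)

_≟ᶜ_ : ∀ {t r} → DecidableEquality (Clique t r)
_≟ᶜ_ = ≡-dec Fin._≟_ Fin._≟_

_≟ᵛ_ : ∀ {t r} → DecidableEquality (Vertex t r)
_≟ᵛ_ = ≡-dec _≟ᶜ_ Fin._≟_

attached : ∀ {t r} → Clique t r → Fin t → Bool
attached (inj₁ i) j = does (i Fin.≟ j)
attached (inj₂ u) j = false

vertexAdj : ∀ {t r} → Vertex t r → Vertex t r → Bool
vertexAdj (inj₁ a) (inj₁ b) = not (does (a ≟ᶜ b))
vertexAdj (inj₁ a) (pend j) = attached a j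
vertexAdj (pend i) (inj₁ b) = attached b i
vertexAdj (pend i) (pend j) = false

module _ (t r : ℕ) where

  attached-correct : ∀ a j → ⌊ toℕ a ℕ.≟ toℕ j ⌋ ≡ attached {t} {r} (to (clique t r) a) j
  attached-correct a j = trans
    (isYes≗does (toℕ a ℕ.≟ toℕ j))
    (trans (cong (λ a → does (toℕ a ℕ.≟ toℕ j)) (sym (strictlyInverseʳ (clique t r) a))) (at (to (clique t r) a)))
    where
    at : ∀ x → does (toℕ (from (clique t r) x) ℕ.≟ toℕ j) ≡ attached x j
    at (inj₁ i) = trans (cong (λ k → does (k ℕ.≟ toℕ j)) (toℕ-↑ˡ i r))
      (does-⇔ (mk⇔ toℕ-injective (cong toℕ)) (toℕ i ℕ.≟ toℕ j) (i Fin.≟ j))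
    at (inj₂ u) = trans (cong (λ k → does (k ℕ.≟ toℕ j)) (toℕ-↑ʳ t u))
      (dec-false (t ℕ.+ toℕ u ℕ.≟ toℕ j) λ eq → ℕ.<⇒≱ (toℕ<n j) (ℕ.≤-trans (ℕ.m≤m+n t (toℕ u)) (ℕ.≤-reflexive eq)))

  vertexAdj-correct : ∀ u v → adj (Kst (t ℕ.+ r) t) u v ≡ vertexAdj (to (vertices t r) u) (to (vertices t r) v)
  vertexAdj-correct u v with splitAt (t ℕ.+ r) u | splitAt (t ℕ.+ r) v
  ... | inj₁ a | inj₁ b = cong not (trans (isYes≗does (a Fin.≟ b)) (sym (does-transport (clique t r) _≟ᶜ_ a b)))
  ... | inj₁ a | inj₂ j = attached-correct a j
  ... | inj₂ i | inj₁ b = attached-correct b i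
  ... | inj₂ i | inj₂ j = refl

vertexDist : ∀ {t r} → Vertex t r → Vertex t r → ℤ
vertexDist (inj₁ a) (inj₁ b) = 1ℤ - δ _≟ᶜ_ a b
vertexDist (att i)  (pend j) = + 2 - δᶠ i j
vertexDist (free u) (pend j) = + 2
vertexDist (pend i) (att j)  = + 2 - δᶠ i j
vertexDist (pend i) (free u) = + 2
vertexDist (pend i) (pend j) = + 3 - + 3 * δᶠ i j

vertexPencil : ∀ {t r} → ℤ → ℤ → Vertex t r → Vertex t r → ℤ
vertexPencil x b i j = x * δ _≟ᵛ_ i j - b * vertexDist i j

module KstMatrix (t r : ℕ) (2≤t : 2 ℕ.≤ t) where

  private
    e = vertices t r

  open Distances (Kst (t ℕ.+ r) t) e vertexAdj (vertexAdj-correct t r)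
    (ℕ.+-mono-≤ (ℕ.≤-trans 2≤t (ℕ.m≤m+n t r)) (ℕ.≤-trans (ℕ.s≤s ℕ.z≤n) 2≤t))

  private
    distinct-adjacent : ∀ {a b : Clique t r} → a ≢ b → vertexAdj {t} {r} (inj₁ a) (inj₁ b) ≡ true
    distinct-adjacent {a} {b} a≢b = cong not (dec-false (a ≟ᶜ b) a≢b)

    attached-self : ∀ j → attached {t} {r} (inj₁ j) j ≡ true
    attached-self j = dec-true (j Fin.≟ j) refl

  vertexDist-correct : ∀ x y → + dist (Kst (t ℕ.+ r) t) (from e x) (from e y) ≡ vertexDist x y
  vertexDist-correct (inj₁ a) (inj₁ b) = case-of (a ≟ᶜ b)
    where
    case-of : Dec (a ≡ b) → _ ≡ vertexDist {t} {r} (inj₁ a) (inj₁ b)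
    case-of (yes refl) = trans (cong +_ (dist≡0 (inj₁ a))) (sym (cong (_-_ 1ℤ) (δ-equal _≟ᶜ_ {a} refl)))
    case-of (no a≢b)   = trans (cong +_ (dist≡1 (a≢b ∘ inj₁-injective) (distinct-adjacent a≢b)))
                               (sym (cong (_-_ 1ℤ) (δ-distinct _≟ᶜ_ a≢b)))
  vertexDist-correct (att i) (pend j) = case-of (i Fin.≟ j)
    where
    case-of : Dec (i ≡ j) → _ ≡ vertexDist {t} {r} (att i) (pend j)
    case-of (yes refl) = trans (cong +_ (dist≡1 {att i} {pend i} (λ ()) (attached-self i)))
                               (sym (cong (_-_ (+ 2)) (δ-equal Fin._≟_ {i} refl)))
    case-of (no i≢j)   = trans (cong +_ (dist≡2 {att i} {pend j} (att j) (λ ()) (dec-false (i Fin.≟ j) i≢j)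
                                 (distinct-adjacent (i≢j ∘ inj₁-injective)) (attached-self j)))
                               (sym (cong (_-_ (+ 2)) (δ-distinct Fin._≟_ i≢j)))
  vertexDist-correct (free u) (pend j) = cong +_ (dist≡2 {free u} {pend j} (att j) (λ ()) refl refl (attached-self j))
  vertexDist-correct (pend i) (att j) = case-of (i Fin.≟ j)
    where
    case-of : Dec (i ≡ j) → _ ≡ vertexDist {t} {r} (pend i) (att j)
    case-of (yes refl) = trans (cong +_ (dist≡1 {pend i} {att i} (λ ()) (attached-self i)))
                               (sym (cong (_-_ (+ 2)) (δ-equal Fin._≟_ {i} refl)))
    case-of (no i≢j)   = trans (cong +_ (dist≡2 {pend i} {att j} (att i) (λ ()) (dec-false (j Fin.≟ i) (i≢j ∘ sym))
                                 (attached-self i) (distinct-adjacent (i≢j ∘ inj₁-injective))))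
                               (sym (cong (_-_ (+ 2)) (δ-distinct Fin._≟_ i≢j)))
  vertexDist-correct (pend i) (free u) = cong +_ (dist≡2 {pend i} {free u} (att i) (λ ()) refl (attached-self i) refl)
  vertexDist-correct (pend i) (pend j) = case-of (i Fin.≟ j)
    where
    case-of : Dec (i ≡ j) → _ ≡ vertexDist {t} {r} (pend i) (pend j)
    case-of (yes refl) = trans (cong +_ (dist≡0 (pend i))) (sym (cong (λ d → + 3 - + 3 * d) (δ-equal Fin._≟_ {i} refl)))
    case-of (no i≢j)   = trans
      (cong +_ (dist≡3 {pend i} {pend j} (att i) (att j) (i≢j ∘ inj₂-injective) refl no-common
        (attached-self i) (distinct-adjacent (i≢j ∘ inj₁-injective)) (attached-self j)))
      (sym (cong (λ d → + 3 - + 3 * d) (δ-distinct Fin._≟_ i≢j)))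
      where
      -- The only neighbour of pendant i is clique vertex i, which is not adjacent to any other
      -- pendant.
      no-common : ∀ z → vertexAdj (pend i) z ≡ true → z ≢ pend j × vertexAdj z (pend j) ≡ false
      no-common (att k) i~k with k Fin.≟ i
      ... | yes refl = (λ ()) , dec-false (i Fin.≟ j) i≢j

  Det-Kst : ∀ x b → detℤ (pencil (Kst (t ℕ.+ r) t) x b) ≡ Det e (vertexPencil x b)
  Det-Kst = Det-pencil (Kst (t ℕ.+ r) t) e _≟ᵛ_ vertexDist vertexDist-correct

  -- In -I - 2D a pendant row minus twice the row of its clique neighbour vanishes on all clique
  -- columns. What remains is I - 2J on the clique and I + 2J on the pendants.
  det-½-Kst : detℤ (pencil (Kst (t ℕ.+ r) t) -1ℤ (+ 2)) ≡ (1ℤ + + (t ℕ.+ r) * - + 2) * (1ℤ + + t * + 2)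
  det-½-Kst = begin
    detℤ (pencil (Kst (t ℕ.+ r) t) -1ℤ (+ 2))  ≡⟨ Det-Kst -1ℤ (+ 2) ⟩
    Det e W′                                   ≡⟨ Det-eliminate e l k A W′ k-l eq ⟨
    Det e A                                    ≡⟨ Det-upperBlock (clique t r) (↔-id (Fin t)) A (λ a j → refl) ⟩
    Det (clique t r) (λ a b → W′ (inj₁ a) (inj₁ b)) * detℤ {t} (λ i j → δᶠ i j + + 2)
      ≡⟨ cong₂ _*_ (trans (Det-cong (clique t r) λ a b → simplify (δ _≟ᶜ_ a b)) (Det-identity+const (clique t r) _≟ᶜ_ (- + 2)))
                   (detℤ-identity+const t (+ 2)) ⟩
    (1ℤ + + (t ℕ.+ r) * - + 2) * (1ℤ + + t * + 2) ∎
    where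
    open ≡-Reasoning
    W′ = vertexPencil -1ℤ (+ 2)
    simplify : ∀ d → -1ℤ * d - + 2 * (1ℤ - d) ≡ d + - + 2
    simplify = solve-∀
    l : Vertex t r → Vertex t r
    l (inj₁ a) = inj₁ a
    l (pend j) = att j
    k : Vertex t r → ℤ
    k (inj₁ a) = 0ℤ
    k (pend j) = - + 2
    k-l : ∀ i → k (l i) ≡ 0ℤ
    k-l (inj₁ a) = refl
    k-l (pend j) = refl
    A : Vertex t r → Vertex t r → ℤ
    A (inj₁ a) j        = W′ (inj₁ a) j
    A (pend i) (inj₁ a) = 0ℤ
    A (pend i) (pend j) = δᶠ i j + + 2
    clique-column : ∀ d → 0ℤ ≡ -1ℤ * 0ℤ - + 2 * (+ 2 - d) + - + 2 * (-1ℤ * d - + 2 * (1ℤ - d))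
    clique-column = solve-∀
    pend-column : ∀ d → d + + 2 ≡ -1ℤ * d - + 2 * (+ 3 - + 3 * d) + - + 2 * (-1ℤ * 0ℤ - + 2 * (+ 2 - d))
    pend-column = solve-∀
    eq : ∀ i j → A i j ≡ W′ i j + k i * W′ (l i) j
    eq (inj₁ a) j        = sym (+-identityʳ (W′ (inj₁ a) j))
    eq (pend i) (att j)  = clique-column (δᶠ i j)
    eq (pend i) (free u) = refl
    eq (pend i) (pend j) = pend-column (δᶠ i j)

-- Order of vanishing at -1 for K_s^t

private
  W : ∀ {t r} → ℤ → Vertex t r → Vertex t r → ℤ
  W x = vertexPencil x 1ℤ

  W-mod : ∀ y {t r} (i j : Vertex t r) → y ∣ W (y - 1ℤ) i j - W -1ℤ i j
  W-mod y i j = divides (δ _≟ᵛ_ i j) (lemma y (δ _≟ᵛ_ i j) (vertexDist i j))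
    where
    lemma : ∀ y δ d → (y - 1ℤ) * δ - 1ℤ * d - (-1ℤ * δ - 1ℤ * d) ≡ δ * y
    lemma = solve-∀

detℤ-neg-identity : ∀ t → detℤ {t} (λ i j → - δᶠ i j) ≡ -1ℤ ^ t
detℤ-neg-identity t = trans
  (detℤ-scale {t} -1ℤ (λ _ → 1) (λ i j → - δᶠ i j) δᶠ λ i j → sym (-1*i≡-i (δᶠ i j)))
  (trans (cong₂ (λ n d → -1ℤ ^ n * d) (sumℕ-ones t) (detℤ-identity t)) (*-identityʳ (-1ℤ ^ t)))

∣-1^n∣≡1 : ∀ n → ∣ -1ℤ ^ n ∣ ≡ 1
∣-1^n∣≡1 zero    = refl
∣-1^n∣≡1 (suc n) = trans (abs-* -1ℤ (-1ℤ ^ n)) (trans (ℕ.+-identityʳ _) (∣-1^n∣≡1 n))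

module FreeVertices (t r : ℕ) where

  private
    e = vertices t (suc r)
    V = Vertex t (suc r)

    -- The reduction modulo y of the pencil at x = y - 1, b = 1, after the row of
    -- the first free vertex is subtracted from the other free rows and these
    -- are divided by y. C₃ is block triangular.
    C : V → V → ℤ
    C (att i)        j = W -1ℤ (att i) j
    C (free zero)    j = W -1ℤ (free zero) j
    C (free (suc u)) j = δ _≟ᵛ_ (free (suc u)) j - δ _≟ᵛ_ (free zero) j
    C (pend i)       j = W -1ℤ (pend i) j

    C₁ : V → V → ℤ
    C₁ (att i)  (inj₁ _) = 0ℤ
    C₁ (att i)  (pend j) = δᶠ i j
    C₁ (free u) j        = C (free u) j
    C₁ (pend i) (att j)  = δᶠ i j
    C₁ (pend i) (free _) = 0ℤ
    C₁ (pend i) (pend j) = 1ℤ + + 2 * δᶠ i j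

    C₂ : V → V → ℤ
    C₂ (att i)  (att j)  = δᶠ i j
    C₂ (att i)  (free _) = 0ℤ
    C₂ (att i)  (pend j) = 1ℤ + + 3 * δᶠ i j
    C₂ (free u) j        = C (free u) j
    C₂ (pend i) j        = C₁ (pend i) j

    C₃ : V → V → ℤ
    C₃ (inj₁ a) j        = C₂ (inj₁ a) j
    C₃ (pend i) (inj₁ _) = 0ℤ
    C₃ (pend i) (pend j) = - δᶠ i j

    same : ∀ a b → a ≡ a + 0ℤ * b
    same = solve-∀

    -- The row of the first free vertex is constantly -1 on the clique and -2 on the pendants. One
    -- copy of it cancels the constant part of an `att` row, two copies that of a `pend` row on the
    -- clique columns.
    Det-C₁ : Det e C₁ ≡ Det e C
    Det-C₁ = Det-eliminate e (λ _ → free zero) k C₁ C (λ _ → refl) eq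
      where
      k : V → ℤ
      k (att i)  = -1ℤ
      k (free u) = 0ℤ
      k (pend i) = - + 2
      att-att : ∀ d → 0ℤ ≡ -1ℤ * d - 1ℤ * (1ℤ - d) + -1ℤ * (-1ℤ * 0ℤ - 1ℤ * (1ℤ - 0ℤ))
      att-att = solve-∀
      att-free : ∀ d → 0ℤ ≡ -1ℤ * 0ℤ - 1ℤ * (1ℤ - 0ℤ) + -1ℤ * (-1ℤ * d - 1ℤ * (1ℤ - d))
      att-free = solve-∀
      att-pend : ∀ d → d ≡ -1ℤ * 0ℤ - 1ℤ * (+ 2 - d) + -1ℤ * (-1ℤ * 0ℤ - 1ℤ * + 2)
      att-pend = solve-∀
      pend-att : ∀ d → d ≡ -1ℤ * 0ℤ - 1ℤ * (+ 2 - d) + - + 2 * (-1ℤ * 0ℤ - 1ℤ * (1ℤ - 0ℤ))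
      pend-att = solve-∀
      pend-free : ∀ d → 0ℤ ≡ -1ℤ * 0ℤ - 1ℤ * + 2 + - + 2 * (-1ℤ * d - 1ℤ * (1ℤ - d))
      pend-free = solve-∀
      pend-pend : ∀ d → 1ℤ + + 2 * d ≡ -1ℤ * d - 1ℤ * (+ 3 - + 3 * d) + - + 2 * (-1ℤ * 0ℤ - 1ℤ * + 2)
      pend-pend = solve-∀
      eq : ∀ i j → C₁ i j ≡ C i j + k i * C (free zero) j
      eq (att i)  (att j)  = att-att (δᶠ i j)
      eq (att i)  (free u) = att-free (δᶠ zero u)
      eq (att i)  (pend j) = att-pend (δᶠ i j)
      eq (free u) j        = same (C (free u) j) (C (free zero) j)
      eq (pend i) (att j)  = pend-att (δᶠ i j)
      eq (pend i) (free u) = pend-free (δᶠ zero u)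
      eq (pend i) (pend j) = pend-pend (δᶠ i j)

    -- The `att` diagonal block of `C₁` is zero; adding the pendant rows brings an identity there to
    -- serve as pivot.
    Det-C₂ : Det e C₂ ≡ Det e C₁
    Det-C₂ = Det-eliminate e l k C₂ C₁ k-l eq
      where
      l : V → V
      l (att i)  = pend i
      l (free u) = free u
      l (pend i) = pend i
      k : V → ℤ
      k (att i)  = 1ℤ
      k (free u) = 0ℤ
      k (pend i) = 0ℤ
      k-l : ∀ i → k (l i) ≡ 0ℤ
      k-l (att i)  = refl
      k-l (free u) = refl
      k-l (pend i) = refl
      att-att : ∀ d → d ≡ 0ℤ + 1ℤ * d
      att-att = solve-∀
      att-pend : ∀ d → 1ℤ + + 3 * d ≡ d + 1ℤ * (1ℤ + + 2 * d)
      att-pend = solve-∀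
      eq : ∀ i j → C₂ i j ≡ C₁ i j + k i * C₁ (l i) j
      eq (att i)  (att j)  = att-att (δᶠ i j)
      eq (att i)  (free u) = refl
      eq (att i)  (pend j) = att-pend (δᶠ i j)
      eq (free u) j        = same (C₁ (free u) j) (C₁ (free u) j)
      eq (pend i) j        = same (C₁ (pend i) j) (C₁ (pend i) j)

    -- That identity clears the clique columns of the pendant rows and leaves (J + 2I) - (J + 3I) =
    -- -I on the pendants.
    Det-C₃ : Det e C₃ ≡ Det e C₂
    Det-C₃ = Det-eliminate e l k C₃ C₂ k-l eq
      where
      l : V → V
      l (inj₁ a) = inj₁ a
      l (pend i) = att i
      k : V → ℤ
      k (inj₁ a) = 0ℤ
      k (pend i) = -1ℤ
      k-l : ∀ i → k (l i) ≡ 0ℤ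
      k-l (inj₁ a) = refl
      k-l (pend i) = refl
      pend-att : ∀ d → 0ℤ ≡ d + -1ℤ * d
      pend-att = solve-∀
      pend-pend : ∀ d → - d ≡ 1ℤ + + 2 * d + -1ℤ * (1ℤ + + 3 * d)
      pend-pend = solve-∀
      eq : ∀ i j → C₃ i j ≡ C₂ i j + k i * C₂ (l i) j
      eq (inj₁ a) j        = same (C₂ (inj₁ a) j) (C₂ (inj₁ a) j)
      eq (pend i) (att j)  = pend-att (δᶠ i j)
      eq (pend i) (free u) = refl
      eq (pend i) (pend j) = pend-pend (δᶠ i j)

    -- The diagonal blocks of `C₃` are I, the free block and -I. The free block has a first row of
    -- -1 and differences of unit vectors below, so its determinant is -(r + 1).
    Det-C : Det e C ≡ + suc r * -1ℤ * -1ℤ ^ t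
    Det-C = begin
      Det e C   ≡⟨ trans (sym Det-C₁) (trans (sym Det-C₂) (sym Det-C₃)) ⟩
      Det e C₃  ≡⟨ Det-upperBlock (clique t (suc r)) (↔-id (Fin t)) C₃ (λ a j → refl) ⟩
      Det (clique t (suc r)) (λ a b → C₃ (inj₁ a) (inj₁ b)) * detℤ {t} (λ i j → - δᶠ i j)
                ≡⟨ cong₂ _*_ (Det-lowerBlock (↔-id (Fin t)) (↔-id (Fin (suc r))) (λ a b → C₃ (inj₁ a) (inj₁ b)) (λ i u → refl)) (detℤ-neg-identity t) ⟩
      detℤ {t} δᶠ * detℤ {suc r} (λ u v → C (free u) (free v)) * -1ℤ ^ t
                ≡⟨ cong (_* -1ℤ ^ t) (cong₂ _*_ (detℤ-identity t) (trans
                     (detℤ-sumRow (λ _ → -1ℤ) (λ u v → C (free u) (free v)) (λ v → constant (δᶠ zero v)) (λ u v → refl))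
                     (sum-const (suc r) -1ℤ))) ⟩
      1ℤ * (+ suc r * -1ℤ) * -1ℤ ^ t
                ≡⟨ cong (_* -1ℤ ^ t) (*-identityˡ (+ suc r * -1ℤ)) ⟩
      + suc r * -1ℤ * -1ℤ ^ t ∎
      where
      open ≡-Reasoning
      constant : ∀ d → -1ℤ * d - 1ℤ * (1ℤ - d) ≡ -1ℤ
      constant = solve-∀

  -- The `suc r` free vertices are adjacent twins, so `r` factors `y` come out. The cofactor is only
  -- needed modulo `y`, where it equals a constant independent of `y`; this leaves `y` to be chosen
  -- afterwards.
  det-Kst-free : 2 ℕ.≤ t → ∀ y → ∃₂ λ d c →
    detℤ (pencil (Kst (t ℕ.+ suc r) t) (y - 1ℤ) 1ℤ) ≡ y ^ r * d × y ∣ d - c × ∣ c ∣ ≡ suc r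
  det-Kst-free 2≤t y = Det e B , Det e C , factor , detℤ-mod y _ _ (λ u v → B-C (to e u) (to e v)) , abs-C
    where
    abs-C : ∣ Det e C ∣ ≡ suc r
    abs-C = begin
      ∣ Det e C ∣                    ≡⟨ cong ∣_∣ Det-C ⟩
      ∣ + suc r * -1ℤ * -1ℤ ^ t ∣    ≡⟨ abs-* (+ suc r * -1ℤ) (-1ℤ ^ t) ⟩
      ∣ + suc r * -1ℤ ∣ ℕ.* ∣ -1ℤ ^ t ∣ ≡⟨ cong₂ ℕ._*_ (abs-* (+ suc r) -1ℤ) (∣-1^n∣≡1 t) ⟩
      suc r ℕ.* 1 ℕ.* 1              ≡⟨ trans (ℕ.*-identityʳ _) (ℕ.*-identityʳ _) ⟩
      suc r                          ∎
      where open ≡-Reasoning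
    W′ = W (y - 1ℤ)
    B : V → V → ℤ
    B (att i)        j = W′ (att i) j
    B (free zero)    j = W′ (free zero) j
    B (free (suc u)) j = C (free (suc u)) j
    B (pend i)       j = W′ (pend i) j
    B-C : ∀ i j → y ∣ B i j - C i j
    B-C (att i)        j = W-mod y (att i) j
    B-C (free zero)    j = W-mod y (free zero) j
    B-C (free (suc u)) j = divides 0ℤ (+-inverseʳ (C (free (suc u)) j))
    B-C (pend i)       j = W-mod y (pend i) j
    d : V → ℕ
    d (att i)  = 0
    d (free u) = if notFirst u then 1 else 0
    d (pend i) = 0
    sum-d : sumℕ (d ∘ to e) ≡ r
    sum-d = begin
      sumℕ (d ∘ to e)
        ≡⟨ sumℕ-⊎ (clique t (suc r)) (↔-id (Fin t)) d ⟩
      sumℕ (d ∘ inj₁ ∘ to (clique t (suc r))) ℕ.+ sumℕ {t} (λ _ → 0)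
        ≡⟨ cong₂ ℕ._+_ (sumℕ-⊎ (↔-id (Fin t)) (↔-id (Fin (suc r))) (d ∘ inj₁)) (sumℕ-zero t) ⟩
      sumℕ {t} (λ _ → 0) ℕ.+ sumℕ {r} (λ _ → 1) ℕ.+ 0
        ≡⟨ ℕ.+-identityʳ _ ⟩
      sumℕ {t} (λ _ → 0) ℕ.+ sumℕ {r} (λ _ → 1)
        ≡⟨ cong₂ ℕ._+_ (sumℕ-zero t) (sumℕ-ones r) ⟩
      r ∎
      where open ≡-Reasoning
    A : V → V → ℤ
    A i j = y ^ d i * B i j
    l : V → V
    l (att i)  = att i
    l (free u) = free zero
    l (pend i) = pend i
    k : V → ℤ
    k (att i)  = 0ℤ
    k (free u) = if notFirst u then -1ℤ else 0ℤ
    k (pend i) = 0ℤ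
    k-l : ∀ i → k (l i) ≡ 0ℤ
    k-l (att i)  = refl
    k-l (free u) = refl
    k-l (pend i) = refl
    kept : ∀ w v → 1ℤ * w ≡ w + 0ℤ * v
    kept = solve-∀
    clique-column : ∀ y d d′ → y * 1ℤ * (d - d′) ≡ (y - 1ℤ) * d - 1ℤ * (1ℤ - d) + -1ℤ * ((y - 1ℤ) * d′ - 1ℤ * (1ℤ - d′))
    clique-column = solve-∀
    pend-column : ∀ y → y * 1ℤ * (0ℤ - 0ℤ) ≡ (y - 1ℤ) * 0ℤ - 1ℤ * + 2 + -1ℤ * ((y - 1ℤ) * 0ℤ - 1ℤ * + 2)
    pend-column = solve-∀
    eq : ∀ i j → A i j ≡ W′ i j + k i * W′ (l i) j
    eq (att i)        j        = kept (W′ (att i) j) (W′ (att i) j)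
    eq (free zero)    j        = kept (W′ (free zero) j) (W′ (free zero) j)
    eq (free (suc u)) (inj₁ b) = clique-column y (δ _≟ᶜ_ (inj₂ (suc u)) b) (δ _≟ᶜ_ (inj₂ zero) b)
    eq (free (suc u)) (pend j) = pend-column y
    eq (pend i)       j        = kept (W′ (pend i) j) (W′ (pend i) j)
    factor : detℤ (pencil (Kst (t ℕ.+ suc r) t) (y - 1ℤ) 1ℤ) ≡ y ^ r * Det e B
    factor = begin
      detℤ (pencil (Kst (t ℕ.+ suc r) t) (y - 1ℤ) 1ℤ) ≡⟨ KstMatrix.Det-Kst t (suc r) 2≤t (y - 1ℤ) 1ℤ ⟩
      Det e W′                              ≡⟨ Det-eliminate e l k A W′ k-l eq ⟨
      Det e A                               ≡⟨ Det-scale e y d A B (λ i j → refl) ⟩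
      y ^ sumℕ (d ∘ to e) * Det e B         ≡⟨ cong (λ n → y ^ n * Det e B) sum-d ⟩
      y ^ r * Det e B                       ∎
      where open ≡-Reasoning

module NoFreeVertex (t : ℕ) where

  private
    e = vertices (suc t) 0
    V = Vertex (suc t) 0

    -- Without free vertices nothing is divisible by y, and y = 0 suffices. The
    -- row operations end in C₅, with diagonal blocks -I and Q.
    C : V → V → ℤ
    C = W -1ℤ

    C₁ : V → V → ℤ
    C₁ (inj₁ a) j        = C (inj₁ a) j
    C₁ (pend i) (att j)  = δᶠ i j
    C₁ (pend i) (pend j) = 1ℤ

    C₂ : V → V → ℤ
    C₂ (att zero)    j        = C (att zero) j
    C₂ (att (suc i)) (att j)  = 0ℤ
    C₂ (att (suc i)) (pend j) = δᶠ (suc i) j - δᶠ zero j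
    C₂ (pend i)      j        = C₁ (pend i) j

    Q : Matrix (suc t)
    Q zero    j = δᶠ zero j + (+ t - 1ℤ)
    Q (suc i) j = δᶠ (suc i) j - δᶠ zero j

    C₃ : V → V → ℤ
    C₃ (att i)  (att j)  = 0ℤ
    C₃ (att i)  (pend j) = Q i j
    C₃ (pend i) j        = C₁ (pend i) j

    C₄ : V → V → ℤ
    C₄ (att i)  (att j)  = - δᶠ i j
    C₄ (att i)  (pend j) = Q i j - 1ℤ
    C₄ (pend i) j        = C₁ (pend i) j

    C₅ : V → V → ℤ
    C₅ (inj₁ a) j        = C₄ (inj₁ a) j
    C₅ (pend i) (inj₁ b) = 0ℤ
    C₅ (pend i) (pend j) = Q i j

    same : ∀ a b → a ≡ a + 0ℤ * b
    same = solve-∀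

    onAtt onPend : ℤ → V → ℤ
    onAtt  c (att i)  = c
    onAtt  c (pend i) = 0ℤ
    onPend c (att i)  = 0ℤ
    onPend c (pend i) = c

    -- Without a free row, the row of its own clique neighbour, taken twice, simplifies each pendant
    -- row to (I, J).
    Det-C₁ : Det e C₁ ≡ Det e C
    Det-C₁ = Det-eliminate e l (onPend (- + 2)) C₁ C (λ { (att i) → refl ; (pend i) → refl }) eq
      where
      l : V → V
      l (att i)  = att i
      l (pend i) = att i
      pend-att : ∀ d → d ≡ -1ℤ * 0ℤ - 1ℤ * (+ 2 - d) + - + 2 * (-1ℤ * d - 1ℤ * (1ℤ - d))
      pend-att = solve-∀
      pend-pend : ∀ d → 1ℤ ≡ -1ℤ * d - 1ℤ * (+ 3 - + 3 * d) + - + 2 * (-1ℤ * 0ℤ - 1ℤ * (+ 2 - d))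
      pend-pend = solve-∀
      eq : ∀ i j → C₁ i j ≡ C i j + onPend (- + 2) i * C (l i) j
      eq (att i)  j        = same (C (att i) j) (C (att i) j)
      eq (pend i) (att j)  = pend-att (δᶠ i j)
      eq (pend i) (pend j) = pend-pend (δᶠ i j)

    Det-C₂ : Det e C₂ ≡ Det e C₁
    Det-C₂ = Det-eliminate e (λ _ → att zero) k C₂ C₁ (λ _ → refl) eq
      where
      k : V → ℤ
      k (att zero)    = 0ℤ
      k (att (suc i)) = -1ℤ
      k (pend i)      = 0ℤ
      att-att : ∀ d d′ → 0ℤ ≡ -1ℤ * d - 1ℤ * (1ℤ - d) + -1ℤ * (-1ℤ * d′ - 1ℤ * (1ℤ - d′))
      att-att = solve-∀
      att-pend : ∀ d d′ → d - d′ ≡ -1ℤ * 0ℤ - 1ℤ * (+ 2 - d) + -1ℤ * (-1ℤ * 0ℤ - 1ℤ * (+ 2 - d′))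
      att-pend = solve-∀
      eq : ∀ i j → C₂ i j ≡ C₁ i j + k i * C₁ (att zero) j
      eq (att zero)    j        = same (C (att zero) j) (C (att zero) j)
      eq (att (suc i)) (att j)  = att-att (δᶠ (suc i) j) (δᶠ zero j)
      eq (att (suc i)) (pend j) = att-pend (δᶠ (suc i) j) (δᶠ zero j)
      eq (pend i)      j        = same (C₁ (pend i) j) (C (att zero) j)

    -- The pendant rows sum to 1 on every clique column and to t + 1 on every pendant column. Adding
    -- them all cancels the last entries -1 in the upper left block and is the origin of the term t
    -- - 1 in `Q`.
    Det-C₃ : Det e C₃ ≡ Det e C₂
    Det-C₃ = Det-addRows e (att zero) inj₂ (λ _ → 1ℤ) C₃ C₂ (λ p ()) others eq
      where
      others : ∀ i → i ≢ att zero → ∀ j → C₃ i j ≡ C₂ i j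
      others (att zero)    i≢ j        = contradiction refl i≢
      others (att (suc i)) i≢ (att j)  = refl
      others (att (suc i)) i≢ (pend j) = refl
      others (pend i)      i≢ j        = refl
      att-att : ∀ d → 0ℤ ≡ -1ℤ * d - 1ℤ * (1ℤ - d) + 1ℤ
      att-att = solve-∀
      att-pend : ∀ d t → d + (t - 1ℤ) ≡ -1ℤ * 0ℤ - 1ℤ * (+ 2 - d) + (1ℤ + t) * 1ℤ
      att-pend = solve-∀
      eq : ∀ j → C₃ (att zero) j ≡ C₂ (att zero) j + sum λ p → 1ℤ * C₂ (pend p) j
      eq (att j)  = trans (att-att (δᶠ zero j))
        (cong (_+_ (C (att zero) (att j))) (sym (sum-δ (λ _ → 1ℤ) j)))
      eq (pend j) = trans (att-pend (δᶠ zero j) (+ t))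
        (cong (_+_ (C (att zero) (pend j))) (sym (sum-const (suc t) 1ℤ)))

    -- `C₃` has block rows (0, Q) and (I, J). This step and the next do the work of exchanging them
    -- by row additions alone: they become (-I, Q - J) and (I, J), then (-I, Q - J) and (0, Q).
    Det-C₄ : Det e C₄ ≡ Det e C₃
    Det-C₄ = Det-eliminate e l (onAtt -1ℤ) C₄ C₃ (λ { (att i) → refl ; (pend i) → refl }) eq
      where
      l : V → V
      l (att i)  = pend i
      l (pend i) = pend i
      att-att : ∀ d → - d ≡ 0ℤ + -1ℤ * d
      att-att = solve-∀
      eq : ∀ i j → C₄ i j ≡ C₃ i j + onAtt -1ℤ i * C₃ (l i) j
      eq (att i)  (att j)  = att-att (δᶠ i j)
      eq (att i)  (pend j) = refl
      eq (pend i) j        = same (C₃ (pend i) j) (C₃ (pend i) j)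

    Det-C₅ : Det e C₅ ≡ Det e C₄
    Det-C₅ = Det-eliminate e l (onPend 1ℤ) C₅ C₄ (λ { (att i) → refl ; (pend i) → refl }) eq
      where
      l : V → V
      l (att i)  = att i
      l (pend i) = att i
      pend-att : ∀ d → 0ℤ ≡ d + 1ℤ * (- d)
      pend-att = solve-∀
      pend-pend : ∀ q → q ≡ 1ℤ + 1ℤ * (q - 1ℤ)
      pend-pend = solve-∀
      eq : ∀ i j → C₅ i j ≡ C₄ i j + onPend 1ℤ i * C₄ (l i) j
      eq (att i)  j        = same (C₄ (att i) j) (C₄ (att i) j)
      eq (pend i) (att j)  = pend-att (δᶠ i j)
      eq (pend i) (pend j) = pend-pend (Q i j)

    -- `Q` has the shape of `detℤ-sumRow`, and its row 0 sums to 1 + (t + 1)(t - 1) = t^2.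
    det-Q : detℤ Q ≡ + (t ℕ.* t)
    det-Q = begin
      detℤ Q   ≡⟨ detℤ-sumRow (Q zero) Q (λ _ → refl) (λ _ _ → refl) ⟩
      1ℤ + (+ t - 1ℤ) + sum {t} (λ j → 0ℤ + (+ t - 1ℤ))
               ≡⟨ cong (_+_ (1ℤ + (+ t - 1ℤ))) (trans (sum-cong-≗ {t} λ _ → +-identityˡ (+ t - 1ℤ)) (sum-const t (+ t - 1ℤ))) ⟩
      1ℤ + (+ t - 1ℤ) + + t * (+ t - 1ℤ) ≡⟨ square (+ t) ⟩
      + t * + t ≡⟨ pos-* t t ⟨
      + (t ℕ.* t) ∎
      where
      open ≡-Reasoning
      square : ∀ t → 1ℤ + (t - 1ℤ) + t * (t - 1ℤ) ≡ t * t
      square = solve-∀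

  abs-det-Kst-0 : 2 ℕ.≤ suc t → ∣ detℤ (pencil (Kst (suc t ℕ.+ 0) (suc t)) -1ℤ 1ℤ) ∣ ≡ t ℕ.* t
  abs-det-Kst-0 2≤t = begin
    ∣ detℤ (pencil (Kst (suc t ℕ.+ 0) (suc t)) -1ℤ 1ℤ) ∣
      ≡⟨ cong ∣_∣ (trans (KstMatrix.Det-Kst (suc t) 0 2≤t -1ℤ 1ℤ) (trans (sym Det-C₁) (trans (sym Det-C₂)
           (trans (sym Det-C₃) (trans (sym Det-C₄) (sym Det-C₅)))))) ⟩
    ∣ Det e C₅ ∣
      ≡⟨ cong ∣_∣ (Det-upperBlock (clique (suc t) 0) (↔-id (Fin (suc t))) C₅ (λ a j → refl)) ⟩
    ∣ Det (clique (suc t) 0) (λ a b → C₅ (inj₁ a) (inj₁ b)) * detℤ Q ∣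
      ≡⟨ cong₂ (λ a b → ∣ a * b ∣)
           (trans (Det-lowerBlock (↔-id (Fin (suc t))) (↔-id (Fin 0)) (λ a b → C₅ (inj₁ a) (inj₁ b)) (λ i ()))
                  (trans (*-identityʳ _) (detℤ-neg-identity (suc t))))
           det-Q ⟩
    ∣ -1ℤ ^ suc t * + (t ℕ.* t) ∣           ≡⟨ abs-* (-1ℤ ^ suc t) (+ (t ℕ.* t)) ⟩
    ∣ -1ℤ ^ suc t ∣ ℕ.* (t ℕ.* t)           ≡⟨ cong (ℕ._* (t ℕ.* t)) (∣-1^n∣≡1 (suc t)) ⟩
    1 ℕ.* (t ℕ.* t)                         ≡⟨ ℕ.*-identityˡ (t ℕ.* t) ⟩
    t ℕ.* t                                 ∎
    where open ≡-Reasoning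

-- Comparison

i^n≢0 : ∀ i n → .{{ℤ.NonZero i}} → ℤ.NonZero (i ^ n)
i^n≢0 i zero    = _
i^n≢0 i (suc n) = i*j≢0 i (i ^ n)
  where instance _ = i^n≢0 i n

sumL-excess : ∀ {ns} → All (1 ≤_) ns → sumL ns ≡ excess ns ℕ.+ length ns
sumL-excess []                           = refl
sumL-excess {suc a ∷ as} (_ ∷ 1≤as) = trans (cong (suc a ℕ.+_) (sumL-excess 1≤as)) (lemma a (excess as) (length as))
  where
  lemma : ∀ a e k → suc a ℕ.+ (e ℕ.+ k) ≡ a ℕ.+ e ℕ.+ suc k
  lemma = ℕ.solve-∀

-- For given k and N the product is least when all the excess sits in one block. Merging excesses a
-- and e costs exactly the term 4ae: (3 + 2a)(3 + 2e) = 3(3 + 2(a + e)) + 4ae. The factor 3 on the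
-- right avoids the exponent k - 1.
product-bound : ∀ {ns} → All (1 ≤_) ns →
  3 ℕ.^ length ns ℕ.* (3 ℕ.+ 2 ℕ.* excess ns) ≤ 3 ℕ.* product (map (λ n → suc (2 ℕ.* n)) ns)
product-bound []                        = ℕ.≤-refl
product-bound {suc a ∷ as} (_ ∷ 1≤as) = begin
  3 ℕ.* 3^k ℕ.* (3 ℕ.+ 2 ℕ.* (a ℕ.+ e))                          ≤⟨ ℕ.m≤m+n _ (3^k ℕ.* (4 ℕ.* (a ℕ.* e))) ⟩
  3 ℕ.* 3^k ℕ.* (3 ℕ.+ 2 ℕ.* (a ℕ.+ e)) ℕ.+ 3^k ℕ.* (4 ℕ.* (a ℕ.* e)) ≡⟨ expand a e 3^k ⟩
  suc (2 ℕ.* suc a) ℕ.* (3^k ℕ.* (3 ℕ.+ 2 ℕ.* e))                 ≤⟨ ℕ.*-monoʳ-≤ (suc (2 ℕ.* suc a)) (product-bound 1≤as) ⟩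
  suc (2 ℕ.* suc a) ℕ.* (3 ℕ.* P)                                 ≡⟨ swap (suc (2 ℕ.* suc a)) P ⟩
  3 ℕ.* (suc (2 ℕ.* suc a) ℕ.* P)                                 ∎
  where
  open ℕ.≤-Reasoning
  e = excess as
  3^k = 3 ℕ.^ length as
  P = product (map (λ n → suc (2 ℕ.* n)) as)
  expand : ∀ a e p → 3 ℕ.* p ℕ.* (3 ℕ.+ 2 ℕ.* (a ℕ.+ e)) ℕ.+ p ℕ.* (4 ℕ.* (a ℕ.* e)) ≡
                     suc (2 ℕ.* suc a) ℕ.* (p ℕ.* (3 ℕ.+ 2 ℕ.* e))
  expand = ℕ.solve-∀
  swap : ∀ a p → a ℕ.* (3 ℕ.* p) ≡ 3 ℕ.* (a ℕ.* p)
  swap = ℕ.solve-∀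

1+2n≤3^n : ∀ n → 1 ℕ.+ 2 ℕ.* n ≤ 3 ℕ.^ n
1+2n≤3^n zero    = ℕ.≤-refl
1+2n≤3^n (suc n) = ℕ.≤-trans (ℕ.≤-trans (ℕ.m≤m+n _ (4 ℕ.* n)) (ℕ.≤-reflexive (lemma n))) (ℕ.*-monoʳ-≤ 3 (1+2n≤3^n n))
  where
  lemma : ∀ n → 1 ℕ.+ 2 ℕ.* suc n ℕ.+ 4 ℕ.* n ≡ 3 ℕ.* (1 ℕ.+ 2 ℕ.* n)
  lemma = ℕ.solve-∀

-- Here t = u + 2, e = N - k and q = r - e, so that k = 3 + 2u + q and the left side is 3(2s - 1)(2t
-- + 1). The factor 2s - 1 is at most (1 + 2u)(1 + 2q)(3 + 2e), and 2t + 1 is less than 9(1 + 2u).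
-- Bernoulli's inequality then absorbs the linear factors in u and q into powers of 3.
power-bound : ∀ u q e →
  3 ℕ.* ((3 ℕ.+ 2 ℕ.* (u ℕ.+ (e ℕ.+ q))) ℕ.* (5 ℕ.+ 2 ℕ.* u)) ℕ.< 3 ℕ.^ (3 ℕ.+ 2 ℕ.* u ℕ.+ q) ℕ.* (3 ℕ.+ 2 ℕ.* e)
power-bound u q e = begin-strict
  3 ℕ.* (S ℕ.* (5 ℕ.+ 2 ℕ.* u))
    ≤⟨ ℕ.*-monoʳ-≤ 3 (ℕ.*-monoˡ-≤ (5 ℕ.+ 2 ℕ.* u) (ℕ.≤-trans (ℕ.m≤m+n S excess-terms) (ℕ.≤-reflexive (slack u q e)))) ⟩
  3 ℕ.* (B ℕ.* (5 ℕ.+ 2 ℕ.* u))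
    <⟨ ℕ.*-monoʳ-< 3 (ℕ.*-monoʳ-< B (ℕ.≤-trans (ℕ.m≤m+n (suc (5 ℕ.+ 2 ℕ.* u)) (3 ℕ.+ 16 ℕ.* u)) (ℕ.≤-reflexive (gap u)))) ⟩
  3 ℕ.* (B ℕ.* (9 ℕ.* (1 ℕ.+ 2 ℕ.* u)))
    ≡⟨ regroup (1 ℕ.+ 2 ℕ.* u) (1 ℕ.+ 2 ℕ.* q) (3 ℕ.+ 2 ℕ.* e) ⟩
  27 ℕ.* ((1 ℕ.+ 2 ℕ.* u) ℕ.* (1 ℕ.+ 2 ℕ.* u)) ℕ.* (1 ℕ.+ 2 ℕ.* q) ℕ.* (3 ℕ.+ 2 ℕ.* e)
    ≤⟨ ℕ.*-monoˡ-≤ (3 ℕ.+ 2 ℕ.* e) (ℕ.*-mono-≤ (ℕ.*-monoʳ-≤ 27 (ℕ.*-mono-≤ (1+2n≤3^n u) (1+2n≤3^n u))) (1+2n≤3^n q)) ⟩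
  27 ℕ.* (3 ℕ.^ u ℕ.* 3 ℕ.^ u) ℕ.* 3 ℕ.^ q ℕ.* (3 ℕ.+ 2 ℕ.* e)
    ≡⟨ cong (ℕ._* (3 ℕ.+ 2 ℕ.* e)) powers ⟨
  3 ℕ.^ (3 ℕ.+ 2 ℕ.* u ℕ.+ q) ℕ.* (3 ℕ.+ 2 ℕ.* e) ∎
  where
  open ℕ.≤-Reasoning
  S = 3 ℕ.+ 2 ℕ.* (u ℕ.+ (e ℕ.+ q))
  B = (1 ℕ.+ 2 ℕ.* u) ℕ.* (1 ℕ.+ 2 ℕ.* q) ℕ.* (3 ℕ.+ 2 ℕ.* e)
  excess-terms = 4 ℕ.* u ℕ.+ 4 ℕ.* q ℕ.+ 12 ℕ.* (u ℕ.* q) ℕ.+ 4 ℕ.* (u ℕ.* e) ℕ.+ 4 ℕ.* (q ℕ.* e) ℕ.+ 8 ℕ.* (u ℕ.* q ℕ.* e)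
  slack : ∀ u q e → 3 ℕ.+ 2 ℕ.* (u ℕ.+ (e ℕ.+ q)) ℕ.+
    (4 ℕ.* u ℕ.+ 4 ℕ.* q ℕ.+ 12 ℕ.* (u ℕ.* q) ℕ.+ 4 ℕ.* (u ℕ.* e) ℕ.+ 4 ℕ.* (q ℕ.* e) ℕ.+ 8 ℕ.* (u ℕ.* q ℕ.* e)) ≡
    (1 ℕ.+ 2 ℕ.* u) ℕ.* (1 ℕ.+ 2 ℕ.* q) ℕ.* (3 ℕ.+ 2 ℕ.* e)
  slack = ℕ.solve-∀
  gap : ∀ u → suc (5 ℕ.+ 2 ℕ.* u) ℕ.+ (3 ℕ.+ 16 ℕ.* u) ≡ 9 ℕ.* (1 ℕ.+ 2 ℕ.* u)
  gap = ℕ.solve-∀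
  regroup : ∀ a b c → 3 ℕ.* (a ℕ.* b ℕ.* c ℕ.* (9 ℕ.* a)) ≡ 27 ℕ.* (a ℕ.* a) ℕ.* b ℕ.* c
  regroup = ℕ.solve-∀
  powers : 3 ℕ.^ (3 ℕ.+ 2 ℕ.* u ℕ.+ q) ≡ 27 ℕ.* (3 ℕ.^ u ℕ.* 3 ℕ.^ u) ℕ.* 3 ℕ.^ q
  powers = trans (ℕ.^-distribˡ-+-* 3 (3 ℕ.+ 2 ℕ.* u) q) (cong (ℕ._* 3 ℕ.^ q)
    (trans (ℕ.^-distribˡ-+-* 3 3 (2 ℕ.* u)) (cong (27 ℕ.*_)
      (trans (ℕ.^-distribˡ-+-* 3 u (u ℕ.+ 0)) (cong (λ v → 3 ℕ.^ u ℕ.* 3 ℕ.^ v) (ℕ.+-identityʳ u))))))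

0^n≡0 : ∀ {n} → 1 ≤ n → 0ℤ ^ n ≡ 0ℤ
0^n≡0 (s≤s _) = refl

^-monoʳ-∣ : ∀ i {m n} → m ≤ n → i ^ m ∣ i ^ n
^-monoʳ-∣ i {m} {n} m≤n = subst (λ k → i ^ m ∣ i ^ k) (ℕ.m+[n∸m]≡n m≤n)
  (subst (i ^ m ∣_) (sym (^-distribˡ-+-* i m (n ℕ.∸ m))) (∣m⇒∣m*n (i ^ (n ℕ.∸ m)) ∣-refl))

-- The number y = r + 2 exceeds |c| = r + 1 > 0, so it does not divide c. If E > r, then y^(r+1)
-- divides y^r d, so y divides d and hence c.
small-remainder : ∀ r E D d c → (+ suc (suc r)) ^ E ∣ D → D ≡ (+ suc (suc r)) ^ r * d →
                  + suc (suc r) ∣ d - c → ∣ c ∣ ≡ suc r → E ≤ r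
small-remainder r E D d c y^E∣D D≡ y∣d-c ∣c∣≡ = ℕ.≮⇒≥ λ r<E →
  ℕ.<⇒≱ (ℕ.n<1+n (suc r)) (ℕ.∣⇒≤ (subst (suc (suc r) ℕ.∣_) ∣c∣≡ (∣⇒∣ᵤ (y∣c r<E))))
  where
  y = + suc (suc r)
  cancel : ∀ d c → d - (d - c) ≡ c
  cancel = solve-∀
  y∣d : r ℕ.< E → y ∣ d
  y∣d r<E = *-cancelˡ-∣ (y ^ r) {{i^n≢0 y r}}
    (subst₂ _∣_ (*-comm y (y ^ r)) D≡ (∣-trans (^-monoʳ-∣ y r<E) y^E∣D))
  y∣c : r ℕ.< E → y ∣ c
  y∣c r<E = subst (y ∣_) (cancel d c) (∣m∣n⇒∣m-n (y∣d r<E) y∣d-c)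

det-Kst-divisible : ∀ t r ns → 2 ≤ sumL ns → DCospectral (Kst (t ℕ.+ r) t) (Kn ns) →
  ∀ y → y ^ excess ns ∣ detℤ (pencil (Kst (t ℕ.+ r) t) (y - 1ℤ) 1ℤ)
det-Kst-divisible t r ns 2≤N cospectral y = subst (y ^ excess ns ∣_)
  (sym (cospectral⇒det {Kst (t ℕ.+ r) t} {Kn ns} cospectral (y - 1ℤ))) (KnMatrix.det-Kn-divisible ns 2≤N y)

excess-bound : ∀ t r ns → 2 ≤ t → 2 ≤ sumL ns → DCospectral (Kst (t ℕ.+ r) t) (Kn ns) → excess ns ≤ r
-- At y = 0 a positive excess would make 0 divide the determinant, whose absolute value t^2 is
-- positive because there are t + 1 ≥ 2 pendants.
excess-bound (suc t) zero ns 2≤t@(s≤s 1≤t) 2≤N cospectral = ℕ.≮⇒≥ λ 0<E →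
  ℕ.m<n⇒n≢0 (ℕ.*-mono-≤ 1≤t 1≤t) (trans (sym (NoFreeVertex.abs-det-Kst-0 t 2≤t))
    (cong ∣_∣ (0∣⇒≡0 (subst (_∣ detℤ (pencil (Kst (suc t ℕ.+ 0) (suc t)) -1ℤ 1ℤ)) (0^n≡0 0<E)
      (det-Kst-divisible (suc t) 0 ns 2≤N cospectral 0ℤ)))))
excess-bound t (suc r) ns 2≤t 2≤N cospectral =
  let d , c , D≡ , y∣d-c , ∣c∣≡ = FreeVertices.det-Kst-free t r 2≤t (+ suc (suc r)) in
  -- With `suc r` free vertices the excess is even at most `r`; the bound is weakened to agree with
  -- the case of no free vertex.
  ℕ.m≤n⇒m≤1+n (small-remainder r (excess ns) (detℤ (pencil (Kst (t ℕ.+ suc r) t) (+ suc (suc r) - 1ℤ) 1ℤ)) d c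
    (det-Kst-divisible t (suc r) ns 2≤N cospectral (+ suc (suc r))) D≡ y∣d-c ∣c∣≡)

-- The two values at -1/2 compared: with t = u + 2 and s = t + r the right side is (2s - 1)(2t + 1).
product-identity : ∀ u r ns → 2 ≤ sumL ns → DCospectral (Kst (2 ℕ.+ u ℕ.+ r) (2 ℕ.+ u)) (Kn ns) →
  product (map (λ n → suc (2 ℕ.* n)) ns) ≡ (3 ℕ.+ 2 ℕ.* (u ℕ.+ r)) ℕ.* (5 ℕ.+ 2 ℕ.* u)
product-identity u r ns 2≤N cospectral = +-injective (begin
  + P                                         ≡⟨ neg-involutive (+ P) ⟨
  - - + P                                     ≡⟨ cong -_ (trans (sym (KnMatrix.det-½-Kn ns 2≤N)) (trans
                                                   (sym (cospectral⇒det-½ {Kst (2 ℕ.+ u ℕ.+ r) (2 ℕ.+ u)} {Kn ns} cospectral))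
                                                   (KstMatrix.det-½-Kst (2 ℕ.+ u) r (s≤s (s≤s z≤n))))) ⟩
  - ((1ℤ + (+ 2 + + u + + r) * - + 2) * (1ℤ + (+ 2 + + u) * + 2)) ≡⟨ lemma (+ u) (+ r) ⟩
  (+ 3 + + 2 * (+ u + + r)) * (+ 5 + + 2 * + u) ≡⟨ cong₂ (λ a b → (+ 3 + a) * (+ 5 + b)) (pos-* 2 (u ℕ.+ r)) (pos-* 2 u) ⟨
  + (3 ℕ.+ 2 ℕ.* (u ℕ.+ r)) * + (5 ℕ.+ 2 ℕ.* u) ≡⟨ pos-* (3 ℕ.+ 2 ℕ.* (u ℕ.+ r)) (5 ℕ.+ 2 ℕ.* u) ⟨
  + ((3 ℕ.+ 2 ℕ.* (u ℕ.+ r)) ℕ.* (5 ℕ.+ 2 ℕ.* u)) ∎)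
  where
  open ≡-Reasoning
  P = product (map (λ n → suc (2 ℕ.* n)) ns)
  lemma : ∀ u r → - ((1ℤ + (+ 2 + u + r) * - + 2) * (1ℤ + (+ 2 + u) * + 2)) ≡ (+ 3 + + 2 * (u + r)) * (+ 5 + + 2 * u)
  lemma = solve-∀

not-cospectral : ∀ u r ns → All (1 ≤_) ns → 2 ℕ.+ u ℕ.+ r ℕ.+ (2 ℕ.+ u) ≡ suc (sumL ns) →
                 ¬ DCospectral (Kst (2 ℕ.+ u ℕ.+ r) (2 ℕ.+ u)) (Kn ns)
not-cospectral u r ns 1≤ns n≡ cospectral = contradict (ℕ.m≤n⇒∃[o]m+o≡n E≤r)
  where
  open ℕ.≤-Reasoning
  E = excess ns
  2≤N : 2 ≤ sumL ns
  2≤N = ℕ.s≤s⁻¹ (subst (3 ≤_) n≡ (ℕ.+-mono-≤ {1} {2 ℕ.+ u ℕ.+ r} (s≤s z≤n) (ℕ.m≤m+n 2 u)))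
  E≤r : E ≤ r
  E≤r = excess-bound (2 ℕ.+ u) r ns (s≤s (s≤s z≤n)) 2≤N cospectral
  count : ∀ u e q → 2 ℕ.+ u ℕ.+ (e ℕ.+ q) ℕ.+ (2 ℕ.+ u) ≡ suc e ℕ.+ (3 ℕ.+ 2 ℕ.* u ℕ.+ q)
  count = ℕ.solve-∀
  -- `q` is the slack r - (N - k), which is also k - (2t - 1).
  contradict : ¬ ∃ λ q → E ℕ.+ q ≡ r
  contradict (q , E+q≡r) = ℕ.<-irrefl refl (begin-strict
    3 ℕ.* ((3 ℕ.+ 2 ℕ.* (u ℕ.+ (E ℕ.+ q))) ℕ.* (5 ℕ.+ 2 ℕ.* u))  <⟨ power-bound u q E ⟩
    3 ℕ.^ (3 ℕ.+ 2 ℕ.* u ℕ.+ q) ℕ.* (3 ℕ.+ 2 ℕ.* E)              ≡⟨ cong (λ k → 3 ℕ.^ k ℕ.* (3 ℕ.+ 2 ℕ.* E)) k≡ ⟨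
    3 ℕ.^ length ns ℕ.* (3 ℕ.+ 2 ℕ.* E)                          ≤⟨ product-bound 1≤ns ⟩
    3 ℕ.* product (map (λ n → suc (2 ℕ.* n)) ns)                 ≡⟨ cong (3 ℕ.*_) (product-identity u r ns 2≤N cospectral) ⟩
    3 ℕ.* ((3 ℕ.+ 2 ℕ.* (u ℕ.+ r)) ℕ.* (5 ℕ.+ 2 ℕ.* u))
      ≡⟨ cong (λ r → 3 ℕ.* ((3 ℕ.+ 2 ℕ.* (u ℕ.+ r)) ℕ.* (5 ℕ.+ 2 ℕ.* u))) E+q≡r ⟨
    3 ℕ.* ((3 ℕ.+ 2 ℕ.* (u ℕ.+ (E ℕ.+ q))) ℕ.* (5 ℕ.+ 2 ℕ.* u)) ∎)
    where
    k≡ : length ns ≡ 3 ℕ.+ 2 ℕ.* u ℕ.+ q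
    k≡ = ℕ.+-cancelˡ-≡ (suc E) (length ns) (3 ℕ.+ 2 ℕ.* u ℕ.+ q)
      (trans (cong suc (sym (sumL-excess 1≤ns))) (trans (sym n≡)
        (trans (cong (λ r → 2 ℕ.+ u ℕ.+ r ℕ.+ (2 ℕ.+ u)) (sym E+q≡r)) (count u E q))))

theorem3p6 : (s t : ℕ) (ns : List ℕ) →
    2 ≤ t → t ≤ s → 2 ≤ length ns → All (1 ≤_) ns →
    s ℕ.+ t ≡ suc (sumL ns) →
    ¬ DCospectral (Kst s t) (Kn ns)
theorem3p6 s (suc (suc u)) ns (s≤s (s≤s _)) t≤s _ 1≤ns n≡ with r , refl ← ℕ.m≤n⇒∃[o]m+o≡n t≤s =
  not-cospectral u r ns 1≤ns n≡
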